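{- Let $u \ge n$. For any $s = \Omega(n)$ and any prime $p = \Omega(u)$, there is a non-adaptive static cell probe data structure for storing an $n$-wise independent hash function $h : [u] \to \mathbb{F}_p$ using $s$ memory cells of $w = \Theta(\lg p)$ bits and answering evaluation queries in $$t = O\left(\frac{\lg(u/n)}{\lg(s/n)}\right)$$ probes.
   Context: Here $[m] = \{0,\dots,m-1\}$, $\lg$ is the base-2 logarithm, and $\mathbb{F}_p$ is the field with $p$ elements. The asymptotic notation $\Omega, \Theta, O$ hides absolute constants; "for any $s=\Omega(n)$ and $p=\Omega(u)$" means for any $s$ at least a sufficiently large absolute constant times $n$ and any $p$ at least a sufficiently large absolute constant times $u$. A (cell probe) data structure storing a random hash function $h:[u]\to\mathbb{F}_p$: upon construction, it draws a random seed and initializes $s$ memory cells (addresses $0,\dots,s-1$) of $w$ bits each as a function of the seed. On an evaluation query $x\in[u]$ it must return $h(x)\in\mathbb{F}_p$, as a function of $x$ and the contents of the cells it probes. Computation is free, and the query time $t$ is the maximum number of cells probed; the parameters and any fixed function of them are known to the query algorithm at no cost. The data structure is non-adaptive if the set of addresses probed on query $x$ depends only on $x$ (not on the seed or on the contents of cells). The hash function is $n$-wise independent if, over the random choice of seed, for any $n$ distinct keys $x_1,\dots,x_n\in[u]$ the values $h(x_1),\dots,h(x_n)$ are independent and each uniformly distributed in $\mathbb{F}_p$.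
   Formalization: The probe bound is taken as t = O(1 + lg(u/n)/lg(s/n)): the literal O(lg(u/n)/lg(s/n)) would force zero probes when u = n, which is impossible for a uniform hash value; n ≥ 1 is assumed so that lg(u/n) makes sense. -}

module Defs where

open import Data.Bool.Base using (Bool)
open import Data.Fin.Base using (Fin)
open import Data.Fin.Properties as Fin using (all?; nonZeroIndex)
open import Data.Integer.Base using (+_)
open import Data.List.Base using (List; []; _∷_; length; filter; allFin)
open import Data.List.Relation.Binary.BagAndSetEquality using (_∼[_]_; set)
open import Data.Nat.Base using (ℕ; NonZero; _*_; _^_; _≤_)
open import Data.Product.Base using (_×_)
open import Data.Rational.Base using (ℚ; _/_)
open import Data.Rational.Properties using (*-1-monoid)
open import Data.Vec.Base using (Vec; lookup)
open import Algebra.Properties.Monoid.Sum *-1-monoid using () renaming (sum to ∏)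
open import Function.Definitions using (Injective)
open import Relation.Binary.PropositionalEquality.Core using (_≡_)
open import Relation.Unary using (Pred; Decidable)

Word : ℕ → Set
Word w = Vec Bool w

Memory : ℕ → ℕ → Set
Memory s w = Vec (Word w) s

-- The query algorithm as a decision tree: each probe may depend on the contents
-- of the cells probed before it, and computation between probes is free.
data Query (s w : ℕ) (A : Set) : Set where
  return : A → Query s w A
  probe  : Fin s → (Word w → Query s w A) → Query s w A

module _ {s w : ℕ} {A : Set} where

  run : Query s w A → Memory s w → A
  run (return a)  m = a
  run (probe i k) m = run (k (lookup m i)) m

  probed : Query s w A → Memory s w → List (Fin s)
  probed (return a)  m = []
  probed (probe i k) m = i ∷ probed (k (lookup m i)) m

-- A data structure for a random function [u] → 𝔽ₚ, with Fin p the underlying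
-- set of 𝔽ₚ. The seed is uniform on Fin seeds.
record HashStructure (u p s w : ℕ) : Set where
  field
    seeds           : ℕ
    ⦃ seeds-nonZero ⦄ : NonZero seeds
    initialise      : Fin seeds → Memory s w
    query           : Fin u → Query s w (Fin p)

  hash : Fin u → Fin seeds → Fin p
  hash x σ = run (query x) (initialise σ)

  NonAdaptive : Set
  NonAdaptive = ∀ x (m m′ : Memory s w) → probed (query x) m ∼[ set ] probed (query x) m′

  QueryTime≤ : ℕ → Set
  QueryTime≤ t = ∀ x (m : Memory s w) → length (probed (query x) m) ≤ t

-- Probability under the uniform distribution on Fin N.
Pr : ∀ {ℓ N} ⦃ _ : NonZero N ⦄ {E : Pred (Fin N) ℓ} → Decidable E → ℚ
Pr {N = N} E? = + length (filter E? (allFin N)) / N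

module _ {N p : ℕ} ⦃ _ : NonZero N ⦄ where

  Uniform : (Fin N → Fin p) → Set
  Uniform X = ∀ y → Pr {N = N} (λ σ → X σ Fin.≟ y) ≡ _/_ (+ 1) p ⦃ nonZeroIndex y ⦄

  -- Mutual independence: the joint mass function is the product of the marginals.
  Independent : ∀ {k} → (Fin k → Fin N → Fin p) → Set
  Independent {k} X = ∀ (y : Fin k → Fin p) →
    Pr {N = N} (λ σ → all? (λ i → X i σ Fin.≟ y i)) ≡ ∏ (λ i → Pr {N = N} (λ σ → X i σ Fin.≟ y i))

WiseIndependent : ∀ {u p s w} → ℕ → HashStructure u p s w → Set
WiseIndependent {u} n D = (x : Fin n → Fin u) → Injective _≡_ _≡_ x →
  Independent (λ i → hash (x i)) × (∀ i → Uniform (hash (x i)))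
  where open HashStructure D

-- lg p / a ≤ w ≤ b · lg p, exponentiated. The first inequality forces a ≥ 1
-- once p ≥ 2.
WordSize : (a b w p : ℕ) → Set
WordSize a b w p = p ≤ 2 ^ (a * w) × 2 ^ w ≤ p ^ b

-- t ≤ c · (1 + lg (u/n) / lg (s/n)), for 1 ≤ n < s: multiplying by lg (s/n) > 0
-- gives t · lg (s/n) ≤ c · lg ((s/n)(u/n)), that is (s/n)ᵗ ≤ ((s/n)(u/n))ᶜ, and
-- then denominators are cleared. The summand 1 accounts for O(·) bounding a number
-- of probes, which cannot drop below 1 when lg (u/n) / lg (s/n) tends to 0
-- (for instance when u = n).
ProbeBound : (c n u s t : ℕ) → Set
ProbeBound c n u s t = s ^ t * (n * n) ^ c ≤ (s * u) ^ c * n ^ t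

{-# OPTIONS --safe #-}
-- Let A be a u × s matrix over 𝔽ₚ with t-sparse rows, any n of which are linearly
-- independent, and store a uniform seed σ ∈ 𝔽ₚˢ: then h(x) = (A σ)ₓ is n-wise independent.
--
-- The supports of the rows come from a random bipartite graph, in which with positive
-- probability every set of k ≤ n keys has at least 2k neighbours. Fill the supports with
-- random coefficients: a vector c with k ≤ n nonzero entries satisfies c A = 0 with
-- probability at most p^(-2k), one factor 1/p for each neighbour of its support, and
-- the sum of p^(-2|c|) over all c ≠ 0 is (1 + (p - 1)/p²)ᵘ - 1 < 1 for p ≥ 3u.
module Submission where

open import Defs
open import Algebra.Bundles using (CommutativeRing)
import Algebra.Properties.Group
import Algebra.Properties.Ring
import Algebra.Properties.Semiring.Sum
open import Algebra.Structures using (IsCommutativeRing)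
open import Data.Bool.Base using (true; false; if_then_else_)
import Data.Bool.Properties as Bool
open import Data.Fin.Base as Fin using (Fin; zero; suc; toℕ; combine; finToFun; funToFin; _↑ˡ_; _↑ʳ_)
open import Data.Fin.Patterns using (0F; 1F)
open import Data.Fin.Permutation using (Permutation′; permutation; _⟨$⟩ʳ_)
open import Data.Fin.Properties as Fin using (all?; any?; remQuot-combine; finToFun-funToFin; funToFin-finToFin; inject≤-injective; 2↔Bool)
open import Data.Integer.Base as ℤ using (ℤ)
import Data.Integer.DivMod as ℤ
import Data.Integer.Properties as ℤ
import Data.Integer.Tactic.RingSolver as ℤSolver
open import Data.List.Base as List using (length; filter; allFin)
open import Data.List.Membership.Propositional using (_∈_)
open import Data.Nat.Base
open import Data.Nat.Coprimality using (prime⇒coprime; coprime-Bézout)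
open import Data.Nat.Divisibility using (divides; >⇒∤)
open import Data.Nat.DivMod using (m<n⇒m%n≡m)
open import Data.Nat.GCD using (module Bézout)
open import Data.Nat.Primality using (Prime; prime⇒nonZero; prime⇒nonTrivial)
open import Data.Nat.Properties
open import Data.Nat.Tactic.RingSolver using (solve-∀)
open import Data.Product.Base using (Σ-syntax; ∃; ∃-syntax; _×_; _,_; proj₁; proj₂)
open import Data.Rational.Base as ℚ using (toℚᵘ)
import Data.Rational.Properties as ℚ
open import Data.Rational.Unnormalised.Base as ℚᵘ using (mkℚᵘ; *≡*)
import Data.Rational.Unnormalised.Properties as ℚᵘ
open import Data.Sum.Base using (_⊎_; inj₁; inj₂)
open import Data.Vec.Base as Vec using (Vec; []; _∷_; lookup; toList)
import Data.Vec.Properties as Vec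
open import Function.Base using (_∘_; it)
open import Function.Bundles using (module Inverse; mk⇔)
open import Function.Definitions using (Injective)
open import Level using (0ℓ)
open import Relation.Binary.Definitions using () renaming (Decidable to Decidable₂)
open import Relation.Binary.PropositionalEquality
import Relation.Binary.Reasoning.Setoid
open import Relation.Nullary using (Dec; yes; no; does; ¬_; contradiction)
open import Relation.Nullary.Decidable using (_×-dec_; _→-dec_; ¬?; dec-true; decidable-stable; map′)
open import Relation.Unary using (Pred; Decidable)
open import Algebra.Properties.Semiring.Sum +-*-semiring using (sum; sum-syntax; sum-cong-≗; ∑-comm; ∑-distrib-+; *-distribˡ-sum; *-distribʳ-sum; sum-permute)
open import Algebra.Properties.CommutativeMonoid.Sum *-1-commutativeMonoid using () renaming (sum to product; sum-cong-≗ to product-cong; ∑-distrib-+ to product-distrib-*)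
open import Algebra.Properties.Monoid.Sum ℚ.*-1-monoid using () renaming (sum to ∏; sum-cong-≗ to ∏-cong)

-- Hall's condition, k neighbours for every k keys, is too weak for random coefficients: a support
-- of size k carries (p - 1)ᵏ vectors c, each annihilated with probability at most p⁻ᵏ, which leaves
-- a bound near 1 for each support and nothing for the union bound over supports. The other k
-- neighbours gain a further p⁻ᵏ, and p ≥ 3u outweighs the number of supports. Asking for 2k
-- neighbours changes only constants in the number of probes.
--
-- That number is 3 + `depth`. In the union bound over key sets S and cell sets T, two probes cancel
-- the number of choices of T, `depth` probes cancel the factor u/n from the choice of S, and one
-- more absorbs the numerical constant.
--
-- Probabilities are counts: a random object is a number below some M, decoded digit by digit with
-- `finToFun`, and sums over all such numbers factorise by `sum-product`. In both existence
-- arguments denominators are multiplied out and subtracted terms moved across, so that every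
-- inequality stays in ℕ.

private variable
  A B : Set
  m n k : ℕ

-- Finite sums and products of natural numbers

sum-mono : {f g : Fin n → ℕ} → (∀ i → f i ≤ g i) → sum f ≤ sum g
sum-mono {zero}  f≤g = z≤n
sum-mono {suc n} f≤g = +-mono-≤ (f≤g zero) (sum-mono (f≤g ∘ suc))

product-mono : {f g : Fin n → ℕ} → (∀ i → f i ≤ g i) → product f ≤ product g
product-mono {zero}  f≤g = ≤-refl
product-mono {suc n} f≤g = *-mono-≤ (f≤g zero) (product-mono (f≤g ∘ suc))

sum-const : ∀ n x → sum {n} (λ _ → x) ≡ n * x
sum-const zero    x = refl
sum-const (suc n) x = cong (x +_) (sum-const n x)

product-const : ∀ n x → product {n} (λ _ → x) ≡ x ^ n
product-const zero    x = refl
product-const (suc n) x = cong (x *_) (product-const n x)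

term≤sum : ∀ (f : Fin n → ℕ) i → f i ≤ sum f
term≤sum f zero    = m≤m+n (f zero) _
term≤sum f (suc i) = ≤-trans (term≤sum (f ∘ suc) i) (m≤n+m _ (f zero))

-- The first-moment method: if bad events number less than one per outcome on average, some outcome
-- has none. The existence of the graph and that of the coefficients both end here.
sum<n⇒∃zero : (f : Fin n → ℕ) → sum f < n → ∃ λ i → f i ≡ 0
sum<n⇒∃zero {suc n} f Σ<n with f zero in f₀
... | zero  = zero , f₀
... | suc y with i , fᵢ ← sum<n⇒∃zero (f ∘ suc) (≤-trans (s≤s (m≤n+m _ y)) (s≤s⁻¹ Σ<n)) = suc i , fᵢ

sum-↑ : ∀ m (f : Fin (m + n) → ℕ) → sum f ≡ sum (f ∘ (_↑ˡ n)) + sum (f ∘ (m ↑ʳ_))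
sum-↑ zero    f = refl
sum-↑ (suc m) f = trans (cong (f zero +_) (sum-↑ m (f ∘ suc))) (sym (+-assoc (f zero) _ _))

sum-combine : ∀ m (f : Fin (m * n) → ℕ) → sum f ≡ ∑[ i < m ] ∑[ j < n ] f (combine i j)
sum-combine zero    f = refl
sum-combine {n} (suc m) f = trans (sum-↑ n f) (cong (sum (λ j → f (combine {suc m} zero j)) +_) (sum-combine m (λ i → f (n ↑ʳ i))))

-- Distributivity, with `c` read as the string of its k digits in base m. In probabilistic terms:
-- the digits of a uniform `c` are independent, so the expectation of a product factorises.
sum-product : ∀ k (f : Fin k → Fin m → ℕ) →
  ∑[ c < m ^ k ] product (λ i → f i (finToFun {m} {k} c i)) ≡ product (λ i → sum (f i))
sum-product zero    f = refl
sum-product {m} (suc k) f = begin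
  ∑[ c < m ^ suc k ] product (λ i → f i (finToFun {m} {suc k} c i))
    ≡⟨ sum-combine {m ^ k} m _ ⟩
  ∑[ a < m ] ∑[ c < m ^ k ] product (λ i → f i (finToFun {m} {suc k} (combine a c) i))
    ≡⟨ sum-cong-≗ (λ a → sum-cong-≗ λ c → cong₂ _*_
         (cong (f zero ∘ proj₁) (remQuot-combine {m} a c))
         (cong (λ rq → product λ i → f (suc i) (finToFun {m} {k} (proj₂ rq) i)) (remQuot-combine {m} a c))) ⟩
  ∑[ a < m ] ∑[ c < m ^ k ] (f zero a * product (λ i → f (suc i) (finToFun {m} {k} c i)))
    ≡⟨ sum-cong-≗ (λ a → sym (*-distribˡ-sum {m ^ k} (f zero a) _)) ⟩
  ∑[ a < m ] (f zero a * ∑[ c < m ^ k ] product (λ i → f (suc i) (finToFun {m} {k} c i)))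
    ≡⟨ sym (*-distribʳ-sum _ (f zero)) ⟩
  sum (f zero) * ∑[ c < m ^ k ] product (λ i → f (suc i) (finToFun {m} {k} c i))
    ≡⟨ cong (sum (f zero) *_) (sum-product k (f ∘ suc)) ⟩
  sum (f zero) * product (λ i → sum (f (suc i))) ∎
  where open ≡-Reasoning

funToFin-cong : ∀ k {f g : Fin k → Fin m} → f ≗ g → funToFin f ≡ funToFin g
funToFin-cong zero    f≗g = refl
funToFin-cong (suc k) f≗g = cong₂ combine (f≗g zero) (funToFin-cong k (f≗g ∘ suc))

-- Indicators and sizes of decidable subsets

𝟙 : Dec A → ℕ
𝟙 a? = if does a? then 1 else 0

𝟙-yes : (a? : Dec A) → A → 𝟙 a? ≡ 1
𝟙-yes (yes _) a = refl
𝟙-yes (no ¬a) a = contradiction a ¬a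

𝟙-no : (a? : Dec A) → ¬ A → 𝟙 a? ≡ 0
𝟙-no (yes a) ¬a = contradiction a ¬a
𝟙-no (no _)  ¬a = refl

𝟙≤1 : (a? : Dec A) → 𝟙 a? ≤ 1
𝟙≤1 (yes _) = ≤-refl
𝟙≤1 (no _)  = z≤n

𝟙-mono : (a? : Dec A) (b? : Dec B) → (A → B) → 𝟙 a? ≤ 𝟙 b?
𝟙-mono (no _)  b? f = z≤n
𝟙-mono (yes a) b? f = ≤-reflexive (sym (𝟙-yes b? (f a)))

𝟙-cong : (a? : Dec A) (b? : Dec B) → (A → B) → (B → A) → 𝟙 a? ≡ 𝟙 b?
𝟙-cong a? b? f g = ≤-antisym (𝟙-mono a? b? f) (𝟙-mono b? a? g)

𝟙-*-≤ : ∀ (a? : Dec A) {x y} → (A → x ≤ y) → 𝟙 a? * x ≤ y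
𝟙-*-≤ (no _)  x≤y = z≤n
𝟙-*-≤ (yes a) {x} x≤y = ≤-trans (≤-reflexive (*-identityˡ x)) (x≤y a)

𝟙-guard : ∀ (a? : Dec A) {x y} → (A → x ≤ y) → 𝟙 a? * x ≤ 𝟙 a? * y
𝟙-guard (no _)  x≤y = z≤n
𝟙-guard (yes a) x≤y = *-monoʳ-≤ 1 (x≤y a)

𝟙-× : (a? : Dec A) (b? : Dec B) → 𝟙 (a? ×-dec b?) ≡ 𝟙 a? * 𝟙 b?
𝟙-× (no _)  b? = refl
𝟙-× (yes _) (no _)  = refl
𝟙-× (yes _) (yes _) = refl

𝟙-all : {P : Pred (Fin n) 0ℓ} (P? : Decidable P) → 𝟙 (all? P?) ≡ product (λ i → 𝟙 (P? i))
𝟙-all {zero}  P? = refl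
𝟙-all {suc n} P? = trans
  (𝟙-cong (all? P?) (P? zero ×-dec all? (λ i → P? (suc i)))
    (λ h → h zero , λ i → h (suc i))
    (λ { (h , hs) zero → h ; (h , hs) (suc i) → hs i }))
  (trans (𝟙-× (P? zero) (all? λ i → P? (suc i))) (cong (𝟙 (P? zero) *_) (𝟙-all (λ i → P? (suc i)))))

size : {P : Pred (Fin n) 0ℓ} → Decidable P → ℕ
size P? = sum (λ i → 𝟙 (P? i))

size-mono : {P Q : Pred (Fin n) 0ℓ} (P? : Decidable P) (Q? : Decidable Q) → (∀ i → P i → Q i) → size P? ≤ size Q?
size-mono P? Q? P⊆Q = sum-mono λ i → 𝟙-mono (P? i) (Q? i) (P⊆Q i)

length-filter : {P : Pred A 0ℓ} (P? : Decidable P) (f : Fin n → A) →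
  length (filter P? (List.tabulate f)) ≡ size (λ i → P? (f i))
length-filter {n = zero}  P? f = refl
length-filter {n = suc n} P? f with does (P? (f zero))
... | true  = cong suc (length-filter P? (f ∘ suc))
... | false = length-filter P? (f ∘ suc)

size-≟ : (j : Fin n) → size (λ i → j Fin.≟ i) ≡ 1
size-≟ {suc n} zero    = cong suc (trans (sum-const n 0) (*-zeroʳ n))
size-≟ {suc n} (suc j) = trans (sum-cong-≗ λ i → 𝟙-cong (suc j Fin.≟ suc i) (j Fin.≟ i) Fin.suc-injective (cong suc)) (size-≟ j)

-- With z the size of P the product is aⁿ⁻ᶻ bᶻ; the extra factor aᶻ avoids subtraction in the
-- exponent.
product-if : {P : Pred (Fin n) 0ℓ} (P? : Decidable P) → ∀ a b →
  product (λ i → if does (P? i) then b else a) * a ^ size P? ≡ a ^ n * b ^ size P?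
product-if {zero}  P? a b = refl
product-if {suc n} P? a b with does (P? zero)
... | true  = begin
  b * x * (a * y) ≡⟨ rearrange b x a y ⟩
  a * b * (x * y) ≡⟨ cong (a * b *_) (product-if (λ i → P? (suc i)) a b) ⟩
  a * b * (a ^ n * z) ≡⟨ *-assoc-middle a b (a ^ n) z ⟩
  a * a ^ n * (b * z) ∎
  where
  open ≡-Reasoning
  x = product (λ i → if does (P? (suc i)) then b else a)
  y = a ^ size (λ i → P? (suc i))
  z = b ^ size (λ i → P? (suc i))
  rearrange : ∀ b x a y → b * x * (a * y) ≡ a * b * (x * y)
  rearrange = solve-∀
  *-assoc-middle : ∀ a b c d → a * b * (c * d) ≡ a * c * (b * d)
  *-assoc-middle = solve-∀
... | false = begin
  a * x * y         ≡⟨ *-assoc a x y ⟩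
  a * (x * y)       ≡⟨ cong (a *_) (product-if (λ i → P? (suc i)) a b) ⟩
  a * (a ^ n * z)   ≡⟨ *-assoc a (a ^ n) z ⟨
  a * a ^ n * z     ∎
  where
  open ≡-Reasoning
  x = product (λ i → if does (P? (suc i)) then b else a)
  y = a ^ size (λ i → P? (suc i))
  z = b ^ size (λ i → P? (suc i))

product-if-1 : {P : Pred (Fin n) 0ℓ} (P? : Decidable P) → ∀ b →
  product (λ i → if does (P? i) then b else 1) ≡ b ^ size P?
product-if-1 {n} P? b = begin
  x                      ≡⟨ *-identityʳ x ⟨
  x * 1                  ≡⟨ cong (x *_) (^-zeroˡ (size P?)) ⟨
  x * 1 ^ size P?        ≡⟨ product-if P? 1 b ⟩
  1 ^ n * b ^ size P?    ≡⟨ cong (_* b ^ size P?) (^-zeroˡ n) ⟩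
  1 * b ^ size P?        ≡⟨ *-identityˡ (b ^ size P?) ⟩
  b ^ size P?            ∎
  where
  open ≡-Reasoning
  x = product (λ i → if does (P? i) then b else 1)

-- Elementary estimates for powers

[1+m]^j*m≤m^j*[m+2j] : ∀ m j → 2 * j ≤ m → suc m ^ j * m ≤ m ^ j * (m + 2 * j)
[1+m]^j*m≤m^j*[m+2j] m zero    _    = ≤-reflexive (cong (1 *_) (sym (+-identityʳ m)))
[1+m]^j*m≤m^j*[m+2j] m (suc j) 2j≤m = begin
  suc m * suc m ^ j * m           ≡⟨ *-assoc (suc m) (suc m ^ j) m ⟩
  suc m * (suc m ^ j * m)         ≤⟨ *-monoʳ-≤ (suc m) ([1+m]^j*m≤m^j*[m+2j] m j (≤-trans (*-monoʳ-≤ 2 (n≤1+n j)) 2j≤m)) ⟩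
  suc m * (m ^ j * (m + 2 * j))   ≡⟨ expand m (m ^ j) j ⟩
  -- The last summand is the second-order term of (1 + 1/m)(1 + 2j/m). Slope 2 instead of 1 leaves
  -- exactly enough room for it when 2j ≤ m.
  m ^ j * (m * m + m * (2 * j) + m + 2 * j)  ≤⟨ *-monoʳ-≤ (m ^ j) (+-monoʳ-≤ (m * m + m * (2 * j) + m) (≤-trans (*-monoʳ-≤ 2 (n≤1+n j)) 2j≤m)) ⟩
  m ^ j * (m * m + m * (2 * j) + m + m) ≡⟨ collect m (m ^ j) j ⟩
  m * m ^ j * (m + 2 * suc j)     ∎
  where
  open ≤-Reasoning
  expand : ∀ m x j → suc m * (x * (m + 2 * j)) ≡ x * (m * m + m * (2 * j) + m + 2 * j)
  expand = solve-∀
  collect : ∀ m x j → x * (m * m + m * (2 * j) + m + m) ≡ m * x * (m + 2 * suc j)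
  collect = solve-∀

[1+m]^j≤2*m^j : ∀ m j → 2 * j ≤ m → suc m ^ j ≤ 2 * m ^ j
[1+m]^j≤2*m^j zero    zero _ = s≤s z≤n
[1+m]^j≤2*m^j m@(suc _) j 2j≤m = *-cancelʳ-≤ _ _ m (begin
  suc m ^ j * m       ≤⟨ [1+m]^j*m≤m^j*[m+2j] m j 2j≤m ⟩
  m ^ j * (m + 2 * j) ≤⟨ *-monoʳ-≤ (m ^ j) (+-monoʳ-≤ m 2j≤m) ⟩
  m ^ j * (m + m)     ≡⟨ double (m ^ j) m ⟩
  2 * m ^ j * m       ∎)
  where
  open ≤-Reasoning
  double : ∀ x m → x * (m + m) ≡ 2 * x * m
  double = solve-∀

[1+m]^j<2*m^j : ∀ m j → 2 * j < m → suc m ^ j < 2 * m ^ j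
[1+m]^j<2*m^j m@(suc _) j 2j<m = *-cancelʳ-< m _ _ (begin-strict
  suc m ^ j * m       ≤⟨ [1+m]^j*m≤m^j*[m+2j] m j (<⇒≤ 2j<m) ⟩
  m ^ j * (m + 2 * j) <⟨ *-monoʳ-< (m ^ j) {{m^n≢0 m j}} (+-monoʳ-< m 2j<m) ⟩
  m ^ j * (m + m)     ≡⟨ double (m ^ j) m ⟩
  2 * m ^ j * m       ∎)
  where
  open ≤-Reasoning
  double : ∀ x m → x * (m + m) ≡ 2 * x * m
  double = solve-∀

-- Each unit added to the base costs at most a factor 2 while the exponent is at most half the base,
-- and enlarging the base preserves that condition.
[m+d]^j≤2^d*m^j : ∀ m j → 2 * j ≤ m → ∀ d → (m + d) ^ j ≤ 2 ^ d * m ^ j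
[m+d]^j≤2^d*m^j m j 2j≤m zero    = ≤-reflexive (trans (cong (_^ j) (+-identityʳ m)) (sym (*-identityˡ (m ^ j))))
[m+d]^j≤2^d*m^j m j 2j≤m (suc d) = begin
  (m + suc d) ^ j      ≡⟨ cong (_^ j) (+-suc m d) ⟩
  suc (m + d) ^ j      ≤⟨ [1+m]^j≤2*m^j (m + d) j (≤-trans 2j≤m (m≤m+n m d)) ⟩
  2 * (m + d) ^ j      ≤⟨ *-monoʳ-≤ 2 ([m+d]^j≤2^d*m^j m j 2j≤m d) ⟩
  2 * (2 ^ d * m ^ j)  ≡⟨ *-assoc 2 (2 ^ d) (m ^ j) ⟨
  2 ^ suc d * m ^ j    ∎
  where open ≤-Reasoning

^-distribʳ-* : ∀ k a b → (a * b) ^ k ≡ a ^ k * b ^ k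
^-distribʳ-* zero    a b = refl
^-distribʳ-* (suc k) a b = trans (cong (a * b *_) (^-distribʳ-* k a b)) (interchange a b (a ^ k) (b ^ k))
  where
  interchange : ∀ a b c d → a * b * (c * d) ≡ a * c * (b * d)
  interchange = solve-∀

-- Subsets as numbers below 2ⁿ, and how many of them are small

Member : ∀ n → Fin (2 ^ n) → Pred (Fin n) 0ℓ
Member n T i = finToFun {2} {n} T i ≡ 1F

member? : ∀ n T → Decidable (Member n T)
member? n T i = finToFun {2} {n} T i Fin.≟ 1F

encode : {P : Pred (Fin n) 0ℓ} → Decidable P → Fin (2 ^ n)
encode P? = funToFin (λ i → if does (P? i) then 1F else 0F)

encode⁺ : {P : Pred (Fin n) 0ℓ} (P? : Decidable P) → ∀ i → P i → Member n (encode P?) i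
encode⁺ P? i p = trans (finToFun-funToFin _ i) (cong (if_then 1F else 0F) (dec-true (P? i) p))

encode⁻ : {P : Pred (Fin n) 0ℓ} (P? : Decidable P) → ∀ i → Member n (encode P?) i → P i
encode⁻ P? i i∈ with P? i | trans (sym (finToFun-funToFin (λ i → if does (P? i) then 1F else 0F) i)) i∈
... | yes p | _ = p
... | no _  | ()

size-encode : {P : Pred (Fin n) 0ℓ} (P? : Decidable P) → size (member? n (encode P?)) ≡ size P?
size-encode {n} P? = ≤-antisym
  (size-mono (member? n (encode P?)) P? (encode⁻ P?)) (size-mono P? (member? n (encode P?)) (encode⁺ P?))

-- Markov's inequality for the weight ∏ (d/2s)^[i ∈ T], whose sum over T factorises;
-- it replaces the usual estimate (e s / d)ᵈ for binomial coefficients.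
subsets≤ : ∀ s .{{_ : NonZero s}} d → d ≤ 2 * s →
  (∑[ T < 2 ^ s ] 𝟙 (size (member? s T) ≤? d)) * d ^ d ≤ (4 * s) ^ d
subsets≤ s@(suc _) d d≤2s = *-cancelʳ-≤ _ _ (b ^ s) {{m^n≢0 b s}} (begin
  sum small * d ^ d * b ^ s                 ≡⟨ *-assoc (sum small) (d ^ d) (b ^ s) ⟩
  sum small * (d ^ d * b ^ s)               ≡⟨ *-distribʳ-sum {2 ^ s} (d ^ d * b ^ s) small ⟩
  ∑[ T < 2 ^ s ] (small T * (d ^ d * b ^ s))  ≤⟨ sum-mono {2 ^ s} small≤weight ⟩
  ∑[ T < 2 ^ s ] (weight T * b ^ d)         ≡⟨ *-distribʳ-sum {2 ^ s} (b ^ d) weight ⟨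
  sum weight * b ^ d                        ≡⟨ cong (_* b ^ d) (sum-product {2} s λ _ c → if does (c Fin.≟ 1F) then d else b) ⟩
  product {s} (λ _ → b + (d + 0)) * b ^ d   ≡⟨ cong (_* b ^ d) (product-const s (b + (d + 0))) ⟩
  (b + (d + 0)) ^ s * b ^ d                 ≡⟨ cong (λ x → (b + x) ^ s * b ^ d) (+-identityʳ d) ⟩
  (b + d) ^ s * b ^ d                       ≤⟨ *-monoˡ-≤ (b ^ d) ([m+d]^j≤2^d*m^j b s ≤-refl d) ⟩
  2 ^ d * b ^ s * b ^ d                     ≡⟨ rearrange (2 ^ d) (b ^ s) (b ^ d) ⟩
  2 ^ d * b ^ d * b ^ s                     ≡⟨ cong (_* b ^ s) (^-distribʳ-* d 2 b) ⟨
  (2 * b) ^ d * b ^ s                       ≡⟨ cong (λ x → x ^ d * b ^ s) (*-assoc 2 2 s) ⟨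
  (4 * s) ^ d * b ^ s                       ∎)
  where
  open ≤-Reasoning
  b = 2 * s
  small weight : Fin (2 ^ s) → ℕ
  small T = 𝟙 (size (member? s T) ≤? d)
  weight T = product (λ i → if does (member? s T i) then d else b)
  rearrange : ∀ x y z → x * y * z ≡ x * z * y
  rearrange = solve-∀
  small≤weight : ∀ T → small T * (d ^ d * b ^ s) ≤ weight T * b ^ d
  small≤weight T = 𝟙-*-≤ (size (member? s T) ≤? d) λ z≤d → begin
    d ^ d * b ^ s               ≡⟨ cong (λ e → d ^ e * b ^ s) (m+[n∸m]≡n z≤d) ⟨
    d ^ (z + e) * b ^ s         ≡⟨ cong (_* b ^ s) (^-distribˡ-+-* d z e) ⟩
    d ^ z * d ^ e * b ^ s       ≤⟨ *-monoˡ-≤ (b ^ s) (*-monoʳ-≤ (d ^ z) (^-monoˡ-≤ e d≤2s)) ⟩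
    d ^ z * b ^ e * b ^ s       ≡⟨ rearrange′ (d ^ z) (b ^ e) (b ^ s) ⟩
    b ^ s * d ^ z * b ^ e       ≡⟨ cong (_* b ^ e) (product-if (member? s T) b d) ⟨
    weight T * b ^ z * b ^ e    ≡⟨ *-assoc (weight T) (b ^ z) (b ^ e) ⟩
    weight T * (b ^ z * b ^ e)  ≡⟨ cong (weight T *_) (^-distribˡ-+-* b z e) ⟨
    weight T * b ^ (z + e)      ≡⟨ cong (λ e → weight T * b ^ e) (m+[n∸m]≡n z≤d) ⟩
    weight T * b ^ d            ∎
    where
    z = size (member? s T)
    e = d ∸ z
    rearrange′ : ∀ x y z → x * y * z ≡ z * x * y
    rearrange′ = solve-∀

-- The terms are at most M/2, M/4, and so on. Doubling the tail restores the hypothesis for it;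
-- strictness comes from the empty tail, 0 < M.
geometric-sum< : ∀ n (f : Fin n → ℕ) M .{{_ : NonZero M}} → (∀ i → f i * 2 ^ suc (toℕ i) ≤ M) → sum f < M
geometric-sum< zero    f M        f≤ = >-nonZero⁻¹ M
geometric-sum< (suc n) f M        f≤ = *-cancelˡ-< 2 _ _ (begin-strict
  2 * (f zero + sum (f ∘ suc))         ≡⟨ *-distribˡ-+ 2 (f zero) (sum (f ∘ suc)) ⟩
  2 * f zero + 2 * sum (f ∘ suc)       ≡⟨ cong₂ _+_ (*-comm 2 (f zero)) (*-distribˡ-sum {n} 2 (f ∘ suc)) ⟩
  f zero * 2 + ∑[ i < n ] (2 * f (suc i))  <⟨ +-mono-≤-< (f≤ zero) (geometric-sum< n (λ i → 2 * f (suc i)) M λ i →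
      ≤-trans (≤-reflexive (shift (f (suc i)) (2 ^ suc (toℕ i)))) (f≤ (suc i))) ⟩
  M + M                                ≡⟨ cong (M +_) (+-identityʳ M) ⟨
  2 * M                                ∎)
  where
  open ≤-Reasoning
  shift : ∀ a b → 2 * a * b ≡ a * (2 * b)
  shift = solve-∀

-- Random bipartite graphs and their expansion

module _ {u s t : ℕ} where

  -- A uniform `ω` gives every key t independent uniform cells, repetitions allowed. The
  -- independence of all u * t choices is what makes the counts below exact products.
  graph : Fin ((s ^ t) ^ u) → Fin u → Fin t → Fin s
  graph ω x = finToFun {s} {t} (finToFun {s ^ t} {u} ω x)

  Into : Pred (Fin u) 0ℓ → Pred (Fin s) 0ℓ → (Fin u → Fin t → Fin s) → Set
  Into S T g = ∀ x → S x → ∀ j → T (g x j)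

  into? : ∀ {S T} → Decidable S → Decidable T → Decidable (Into S T)
  into? S? T? g = all? λ x → S? x →-dec all? λ j → T? (g x j)

  -- The keys choose independently: one in S has |T|ᵗ admissible choices, one outside S is free.
  sum-into : ∀ {S T} (S? : Decidable S) (T? : Decidable T) →
    ∑[ ω < (s ^ t) ^ u ] 𝟙 (into? S? T? (graph ω)) ≡ product (λ x → if does (S? x) then size T? ^ t else s ^ t)
  sum-into S? T? = begin
    ∑[ ω < (s ^ t) ^ u ] 𝟙 (into? S? T? (graph ω))
      ≡⟨ sum-cong-≗ {(s ^ t) ^ u} (λ ω → 𝟙-all (λ x → S? x →-dec all? λ j → T? (graph ω x j))) ⟩
    ∑[ ω < (s ^ t) ^ u ] product (λ x → row x (finToFun {s ^ t} {u} ω x))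
      ≡⟨ sum-product {s ^ t} u row ⟩
    product (λ x → sum (row x))
      ≡⟨ product-cong (λ x → sum-row x) ⟩
    product (λ x → if does (S? x) then size T? ^ t else s ^ t) ∎
    where
    open ≡-Reasoning
    row : Fin u → Fin (s ^ t) → ℕ
    row x y = 𝟙 (S? x →-dec all? λ j → T? (finToFun {s} {t} y j))
    sum-row : ∀ x → sum (row x) ≡ (if does (S? x) then size T? ^ t else s ^ t)
    sum-row x with S? x
    ... | no ¬Sx = trans (sum-const (s ^ t) 1) (*-identityʳ (s ^ t))
    ... | yes Sx = begin
      ∑[ y < s ^ t ] 𝟙 (yes Sx →-dec all? λ j → T? (finToFun {s} {t} y j))
        ≡⟨ sum-cong-≗ {s ^ t} (λ y → 𝟙-cong (yes Sx →-dec all? λ j → T? (finToFun {s} {t} y j)) (all? λ j → T? (finToFun {s} {t} y j)) (λ f → f Sx) (λ f _ → f)) ⟩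
      ∑[ y < s ^ t ] 𝟙 (all? λ j → T? (finToFun {s} {t} y j))
        ≡⟨ sum-cong-≗ {s ^ t} (λ y → 𝟙-all (λ j → T? (finToFun {s} {t} y j))) ⟩
      ∑[ y < s ^ t ] product (λ j → 𝟙 (T? (finToFun {s} {t} y j)))
        ≡⟨ sum-product {s} t (λ _ i → 𝟙 (T? i)) ⟩
      product {t} (λ _ → size T?)
        ≡⟨ product-const t (size T?) ⟩
      size T? ^ t ∎

  sum-into≤ : ∀ {S T} (S? : Decidable S) (T? : Decidable T) d → size T? ≤ d →
    (∑[ ω < (s ^ t) ^ u ] 𝟙 (into? S? T? (graph ω))) * (s ^ t) ^ size S? ≤ (s ^ t) ^ u * (d ^ t) ^ size S?
  sum-into≤ S? T? d T≤d = begin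
    (∑[ ω < (s ^ t) ^ u ] 𝟙 (into? S? T? (graph ω))) * (s ^ t) ^ size S?
      ≡⟨ cong (_* (s ^ t) ^ size S?) (sum-into S? T?) ⟩
    product (λ x → if does (S? x) then size T? ^ t else s ^ t) * (s ^ t) ^ size S?
      ≡⟨ product-if S? (s ^ t) (size T? ^ t) ⟩
    (s ^ t) ^ u * (size T? ^ t) ^ size S?
      ≤⟨ *-monoʳ-≤ ((s ^ t) ^ u) (^-monoˡ-≤ (size S?) (^-monoˡ-≤ t T≤d)) ⟩
    (s ^ t) ^ u * (d ^ t) ^ size S? ∎
    where open ≤-Reasoning

^-distribʳ-*₄ : ∀ k a b c d → a ^ k * b ^ k * c ^ k * d ^ k ≡ (a * b * c * d) ^ k
^-distribʳ-*₄ k a b c d = sym (begin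
  (a * b * c * d) ^ k            ≡⟨ ^-distribʳ-* k (a * b * c) d ⟩
  (a * b * c) ^ k * d ^ k        ≡⟨ cong (_* d ^ k) (^-distribʳ-* k (a * b) c) ⟩
  (a * b) ^ k * c ^ k * d ^ k    ≡⟨ cong (λ x → x * c ^ k * d ^ k) (^-distribʳ-* k a b) ⟩
  a ^ k * b ^ k * c ^ k * d ^ k  ∎)
  where open ≡-Reasoning

-- If the bound holds at k = n it holds below, as (2k)ʳ⁺¹ / k is nondecreasing in k.
density-mono : ∀ c k n s r → .{{_ : NonZero n}} → k ≤ n →
  c * (2 * n) ^ suc r ≤ s ^ suc r * n → c * (2 * k) ^ suc r ≤ s ^ suc r * k
density-mono c k n s r k≤n dense = *-cancelʳ-≤ _ _ n (begin
  c * (2 * k * (2 * k) ^ r) * n   ≤⟨ *-monoˡ-≤ n (*-monoʳ-≤ c (*-monoʳ-≤ (2 * k) (^-monoˡ-≤ r (*-monoʳ-≤ 2 k≤n)))) ⟩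
  c * (2 * k * (2 * n) ^ r) * n   ≡⟨ swap c k n ((2 * n) ^ r) ⟩
  c * (2 * n * (2 * n) ^ r) * k   ≤⟨ *-monoˡ-≤ k dense ⟩
  s ^ suc r * n * k               ≡⟨ swap′ (s ^ suc r) n k ⟩
  s ^ suc r * k * n               ∎)
  where
  open ≤-Reasoning
  swap : ∀ c k n x → c * (2 * k * x) * n ≡ c * (2 * n * x) * k
  swap = solve-∀
  swap′ : ∀ a b c → a * b * c ≡ a * c * b
  swap′ = solve-∀

-- Up to a k-th power, there are 4u/k choices of S and (4s/2k)² choices of T, each pair is bad with
-- probability (2k/s)²⁺ʳ, and a factor 2 is reserved for the geometric sum over k. Two of the
-- factors 2k/s cancel (s/2k)², and what remains is 128 (u/k)(2k/s)ʳ with 128 = 4 · 4² · 2.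
union-bound-term : ∀ E #S #T M u s r k .{{_ : NonZero s}} .{{_ : NonZero k}} →
  E * (s ^ (2 + r)) ^ k ≤ #S * (#T * (M * ((2 * k) ^ (2 + r)) ^ k)) →
  #S * k ^ k ≤ (4 * u) ^ k → #T * (2 * k) ^ (2 * k) ≤ (4 * s) ^ (2 * k) →
  128 * u * (2 * k) ^ r ≤ s ^ r * k →
  E * 2 ^ k ≤ M
union-bound-term E #S #T M u s r k E≤ S≤ T≤ dense = *-cancelʳ-≤ _ _ (X ^ k) {{m^n≢0 X k}} (begin
  E * 2 ^ k * X ^ k
    ≡⟨ cong (E * 2 ^ k *_) (^-distribʳ-*₄ k (s ^ (2 + r)) k (d * d) 1) ⟨
  E * 2 ^ k * ((s ^ (2 + r)) ^ k * k ^ k * (d * d) ^ k * 1 ^ k)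
    ≡⟨ regroup₁ E (2 ^ k) ((s ^ (2 + r)) ^ k) (k ^ k) ((d * d) ^ k) (1 ^ k) ⟩
  E * (s ^ (2 + r)) ^ k * (k ^ k * (d * d) ^ k * (2 ^ k * 1 ^ k))
    ≤⟨ *-monoˡ-≤ _ E≤ ⟩
  #S * (#T * (M * (d ^ (2 + r)) ^ k)) * (k ^ k * (d * d) ^ k * (2 ^ k * 1 ^ k))
    ≡⟨ regroup₂ #S #T M ((d ^ (2 + r)) ^ k) (k ^ k) ((d * d) ^ k) (2 ^ k * 1 ^ k) ⟩
  #S * k ^ k * (#T * (d * d) ^ k) * (M * ((d ^ (2 + r)) ^ k * (2 ^ k * 1 ^ k)))
    ≤⟨ *-monoˡ-≤ _ (*-mono-≤ S≤ T≤′) ⟩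
  (4 * u) ^ k * (4 * s * (4 * s)) ^ k * (M * ((d ^ (2 + r)) ^ k * (2 ^ k * 1 ^ k)))
    ≡⟨ cong (λ o → (4 * u) ^ k * (4 * s * (4 * s)) ^ k * (M * ((d ^ (2 + r)) ^ k * (2 ^ k * o)))) (^-zeroˡ k) ⟩
  (4 * u) ^ k * (4 * s * (4 * s)) ^ k * (M * ((d ^ (2 + r)) ^ k * (2 ^ k * 1)))
    ≡⟨ regroup₃ M ((4 * u) ^ k) ((4 * s * (4 * s)) ^ k) ((d ^ (2 + r)) ^ k) (2 ^ k) ⟩
  M * ((4 * u) ^ k * (4 * s * (4 * s)) ^ k * (d ^ (2 + r)) ^ k * 2 ^ k)
    ≡⟨ cong (M *_) (^-distribʳ-*₄ k (4 * u) (4 * s * (4 * s)) (d ^ (2 + r)) 2) ⟩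
  M * (4 * u * (4 * s * (4 * s)) * d ^ (2 + r) * 2) ^ k
    ≡⟨ cong (λ x → M * x ^ k) (regroup₄ u s d (d ^ r)) ⟩
  M * (128 * u * d ^ r * (s * s * (d * d))) ^ k
    ≤⟨ *-monoʳ-≤ M (^-monoˡ-≤ k (*-monoˡ-≤ (s * s * (d * d)) dense)) ⟩
  M * (s ^ r * k * (s * s * (d * d))) ^ k
    ≡⟨ cong (λ x → M * x ^ k) (regroup₅ (s ^ r) k s d) ⟩
  M * X ^ k ∎)
  where
  open ≤-Reasoning
  d = 2 * k
  -- The common denominator of the k-th roots; the final 1 fills the fourth slot of `^-distribʳ-*₄`.
  X = s ^ (2 + r) * k * (d * d) * 1
  instance
    d≢0 : NonZero d
    d≢0 = m*n≢0 2 k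
    X≢0 : NonZero X
    X≢0 = m*n≢0 (s ^ (2 + r) * k * (d * d)) 1 {{m*n≢0 (s ^ (2 + r) * k) (d * d) {{m*n≢0 (s ^ (2 + r)) k {{m^n≢0 s (2 + r)}}}} {{m*n≢0 d d}}}}
  square : ∀ x → x ^ (2 * k) ≡ (x * x) ^ k
  square x = trans (sym (^-*-assoc x 2 k)) (cong (λ y → (x * y) ^ k) (*-identityʳ x))
  T≤′ : #T * (d * d) ^ k ≤ (4 * s * (4 * s)) ^ k
  T≤′ = subst₂ _≤_ (cong (#T *_) (square d)) (square (4 * s)) T≤
  regroup₁ : ∀ e b a c f o → e * b * (a * c * f * o) ≡ e * a * (c * f * (b * o))
  regroup₁ = solve-∀
  regroup₂ : ∀ a b m x c f o → a * (b * (m * x)) * (c * f * o) ≡ a * c * (b * f) * (m * (x * o))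
  regroup₂ = solve-∀
  regroup₃ : ∀ m a b x c → a * b * (m * (x * (c * 1))) ≡ m * (a * b * x * c)
  regroup₃ = solve-∀
  regroup₄ : ∀ u s d x → 4 * u * (4 * s * (4 * s)) * (d * (d * x)) * 2 ≡ 128 * u * x * (s * s * (d * d))
  regroup₄ = solve-∀
  regroup₅ : ∀ x k s d → x * k * (s * s * (d * d)) ≡ s * (s * x) * k * (d * d) * 1
  regroup₅ = solve-∀

Neighbour : ∀ {u t s} → (Fin u → Fin t → Fin s) → Pred (Fin u) 0ℓ → Pred (Fin s) 0ℓ
Neighbour g S i = ∃ λ x → S x × ∃ λ j → g x j ≡ i

neighbour? : ∀ {u t s} (g : Fin u → Fin t → Fin s) {S} → Decidable S → Decidable (Neighbour g S)
neighbour? g S? i = any? λ x → S? x ×-dec any? λ j → g x j Fin.≟ i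

module _ (n u s r : ℕ) .{{_ : NonZero u}} .{{_ : NonZero s}} (n≤u : n ≤ u) (n≤s : n ≤ s)
  (dense : 128 * u * (2 * n) ^ suc r ≤ s ^ suc r * n) where

  private
    t M : ℕ
    t = 2 + suc r
    M = (s ^ t) ^ u

    -- If S fails to expand, its neighbourhood serves as T. Fixing T in advance makes the event a
    -- product over keys. Such a neighbourhood has fewer than 2k cells; allowing 2k is harmless and
    -- fits `subsets≤`.
    Bad : ℕ → Fin (2 ^ u) → Fin (2 ^ s) → Fin M → Set
    Bad k S T ω = size (member? u S) ≡ k × size (member? s T) ≤ 2 * k × Into (Member u S) (Member s T) (graph {u} {s} {t} ω)

    bad? : ∀ k S T → Decidable (Bad k S T)
    bad? k S T ω = size (member? u S) ≟ k ×-dec size (member? s T) ≤? 2 * k ×-dec into? (member? u S) (member? s T) (graph {u} {s} {t} ω)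

    #S #T E : ℕ → ℕ
    #S k = ∑[ S < 2 ^ u ] 𝟙 (size (member? u S) ≤? k)
    #T k = ∑[ T < 2 ^ s ] 𝟙 (size (member? s T) ≤? 2 * k)
    E k = ∑[ S < 2 ^ u ] ∑[ T < 2 ^ s ] ∑[ ω < M ] 𝟙 (bad? k S T ω)

    bad≤ : ∀ k S T → (∑[ ω < M ] 𝟙 (bad? k S T ω)) * (s ^ t) ^ k
      ≤ 𝟙 (size (member? u S) ≤? k) * (𝟙 (size (member? s T) ≤? 2 * k) * (M * ((2 * k) ^ t) ^ k))
    bad≤ k S T = begin
      (∑[ ω < M ] 𝟙 (bad? k S T ω)) * (s ^ t) ^ k
        ≡⟨ cong (_* (s ^ t) ^ k) (sum-cong-≗ {M} λ ω → trans (𝟙-× a? (b? ×-dec c? ω)) (cong (𝟙 a? *_) (𝟙-× b? (c? ω)))) ⟩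
      (∑[ ω < M ] (𝟙 a? * (𝟙 b? * 𝟙 (c? ω)))) * (s ^ t) ^ k
        ≡⟨ cong (_* (s ^ t) ^ k) (trans (cong (𝟙 a? *_) (*-distribˡ-sum {M} (𝟙 b?) (𝟙 ∘ c?))) (*-distribˡ-sum {M} (𝟙 a?) _)) ⟨
      𝟙 a? * (𝟙 b? * (∑[ ω < M ] 𝟙 (c? ω))) * (s ^ t) ^ k
        ≡⟨ reassoc (𝟙 a?) (𝟙 b?) (∑[ ω < M ] 𝟙 (c? ω)) ((s ^ t) ^ k) ⟩
      𝟙 a? * (𝟙 b? * ((∑[ ω < M ] 𝟙 (c? ω)) * (s ^ t) ^ k))
        -- The exact size k of S is used here, to match exponents; the next step weakens it to at
        -- most k, the form that `subsets≤` counts.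
        ≤⟨ 𝟙-guard a? (λ { refl → 𝟙-guard b? (sum-into≤ (member? u S) (member? s T) (2 * k)) }) ⟩
      𝟙 a? * (𝟙 b? * (M * ((2 * k) ^ t) ^ k))
        ≤⟨ *-monoˡ-≤ _ (𝟙-mono a? (size (member? u S) ≤? k) ≤-reflexive) ⟩
      𝟙 (size (member? u S) ≤? k) * (𝟙 b? * (M * ((2 * k) ^ t) ^ k)) ∎
      where
      open ≤-Reasoning
      a? = size (member? u S) ≟ k
      b? = size (member? s T) ≤? 2 * k
      c? = λ ω → into? (member? u S) (member? s T) (graph {u} {s} {t} ω)
      reassoc : ∀ a b c d → a * (b * c) * d ≡ a * (b * (c * d))
      reassoc = solve-∀

    E≤ : ∀ k → E k * (s ^ t) ^ k ≤ #S k * (#T k * (M * ((2 * k) ^ t) ^ k))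
    E≤ k = begin
      E k * Y
        ≡⟨ *-distribʳ-sum {2 ^ u} Y _ ⟩
      ∑[ S < 2 ^ u ] ((∑[ T < 2 ^ s ] ∑[ ω < M ] 𝟙 (bad? k S T ω)) * Y)
        ≡⟨ sum-cong-≗ {2 ^ u} (λ S → *-distribʳ-sum {2 ^ s} Y _) ⟩
      ∑[ S < 2 ^ u ] ∑[ T < 2 ^ s ] ((∑[ ω < M ] 𝟙 (bad? k S T ω)) * Y)
        ≤⟨ sum-mono {2 ^ u} (λ S → sum-mono {2 ^ s} (bad≤ k S)) ⟩
      ∑[ S < 2 ^ u ] ∑[ T < 2 ^ s ] (σ S * (τ T * Z))
        ≡⟨ sum-cong-≗ {2 ^ u} (λ S → trans (cong (σ S *_) (*-distribʳ-sum {2 ^ s} Z τ)) (*-distribˡ-sum {2 ^ s} (σ S) _)) ⟨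
      ∑[ S < 2 ^ u ] (σ S * (#T k * Z))
        ≡⟨ *-distribʳ-sum {2 ^ u} (#T k * Z) σ ⟨
      #S k * (#T k * Z) ∎
      where
      open ≤-Reasoning
      Y = (s ^ t) ^ k
      Z = M * ((2 * k) ^ t) ^ k
      σ = λ S → 𝟙 (size (member? u S) ≤? k)
      τ = λ T → 𝟙 (size (member? s T) ≤? 2 * k)

    bad : Fin M → Fin n → ℕ
    bad ω κ = ∑[ S < 2 ^ u ] ∑[ T < 2 ^ s ] 𝟙 (bad? (suc (toℕ κ)) S T ω)

    -- Exchanging sums gives one total per size k = 1, ..., n, and the total for k is at most M/2ᵏ.
    -- The index `κ` starts at 0, hence the `suc`.
    sum-bad< : ∑[ ω < M ] sum (bad ω) < M
    sum-bad< = subst (_< M) (sym swap) (geometric-sum< n (λ κ → E (suc (toℕ κ))) M {{m^n≢0 (s ^ t) u {{m^n≢0 s t}}}} λ κ → term (toℕ κ) (Fin.toℕ<n κ))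
      where
      swap : ∑[ ω < M ] sum (bad ω) ≡ ∑[ κ < n ] E (suc (toℕ κ))
      swap = trans (∑-comm {M} {n} bad) (sum-cong-≗ {n} λ κ →
        trans (∑-comm {M} {2 ^ u} _) (sum-cong-≗ {2 ^ u} λ S → ∑-comm {M} {2 ^ s} _))
      term : ∀ k → k < n → E (suc k) * 2 ^ suc k ≤ M
      term k k<n = union-bound-term (E (suc k)) (#S (suc k)) (#T (suc k)) M u s (suc r) (suc k) (E≤ (suc k))
        (subsets≤ u (suc k) (≤-trans k<n (≤-trans n≤u (m≤m+n u _))))
        (subsets≤ s (2 * suc k) (*-monoʳ-≤ 2 (≤-trans k<n n≤s)))
        (density-mono (128 * u) (suc k) n s r {{>-nonZero (≤-trans (s≤s z≤n) k<n)}} k<n dense)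

    good : ∃ λ ω → sum (bad ω) ≡ 0
    good = sum<n⇒∃zero (λ ω → sum (bad ω)) sum-bad<

    g : Fin u → Fin t → Fin s
    g = graph {u} {s} {t} (proj₁ good)

    never-bad : ∀ κ S T → ¬ Bad (suc (toℕ κ)) S T (proj₁ good)
    never-bad κ S T b = contradiction (begin-strict
      0                                <⟨ s≤s z≤n ⟩
      1                                ≡⟨ 𝟙-yes (bad? (suc (toℕ κ)) S T ω) b ⟨
      𝟙 (bad? (suc (toℕ κ)) S T ω)     ≤⟨ term≤sum {2 ^ s} (λ T → 𝟙 (bad? (suc (toℕ κ)) S T ω)) T ⟩
      ∑[ T < 2 ^ s ] 𝟙 (bad? (suc (toℕ κ)) S T ω)
                                       ≤⟨ term≤sum {2 ^ u} (λ S → ∑[ T < 2 ^ s ] 𝟙 (bad? (suc (toℕ κ)) S T ω)) S ⟩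
      bad ω κ                          ≤⟨ term≤sum (bad ω) κ ⟩
      sum (bad ω)                      ≡⟨ proj₂ good ⟩
      0                                ∎) λ ()
      where
      open ≤-Reasoning
      ω = proj₁ good

    expands : ∀ {S} (S? : Decidable S) z → size S? ≡ z → z ≤ n → 2 * z ≤ size (neighbour? g S?)
    expands S? zero    _    _   = z≤n
    expands S? (suc k) size≡ k<n = ≮⇒≥ λ small → never-bad κ (encode S?) (encode (neighbour? g S?))
      ( trans (size-encode S?) (trans size≡ (cong suc (sym (Fin.toℕ-fromℕ< k<n))))
      , ≤-trans (≤-reflexive (size-encode (neighbour? g S?)))
          (≤-trans (<⇒≤ small) (≤-reflexive (cong (λ k → 2 * suc k) (sym (Fin.toℕ-fromℕ< k<n)))))
      , λ x Sx j → encode⁺ (neighbour? g S?) (g x j) (x , encode⁻ S? x Sx , j , refl))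
      where κ = Fin.fromℕ< k<n

  -- Opaque, because unfolding the witness would run the search over all graphs.
  opaque
    expander : ∃ λ (g : Fin u → Fin (3 + r) → Fin s) → ∀ {S} (S? : Decidable S) →
      size S? ≤ n → 2 * size S? ≤ size (neighbour? g S?)
    expander = g , λ S? → expands S? (size S?) refl

-- Finite fields and Gaussian elimination

record FiniteField (q : ℕ) : Set₁ where
  field
    commutativeRing : CommutativeRing 0ℓ 0ℓ
  open CommutativeRing commutativeRing using (Carrier; _≈_; 0#; 1#) renaming (_*_ to _⊗_)
  field
    index         : Carrier → Fin q
    element       : Fin q → Carrier
    index-cong    : ∀ {a b} → a ≈ b → index a ≡ index b
    element-index : ∀ a → element (index a) ≈ a
    index-element : ∀ i → index (element i) ≡ i
    1≉0           : ¬ 1# ≈ 0#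
    inverse       : ∀ a → ¬ a ≈ 0# → ∃ λ b → b ⊗ a ≈ 1#

module LinearAlgebra {q : ℕ} (F : FiniteField q) where
  open FiniteField F
  open CommutativeRing commutativeRing public
    using (Carrier; _≈_; 0#; 1#)
    renaming (_+_ to _⊕_; _*_ to _⊗_; -_ to ⊖_)
  private
    module R = CommutativeRing commutativeRing
    module R-group = Algebra.Properties.Group R.+-group
    module R-ring = Algebra.Properties.Ring R.ring
    module ΣR = Algebra.Properties.Semiring.Sum R.semiring
    module ≈-Reasoning = Relation.Binary.Reasoning.Setoid R.setoid

  infix 4 _≈?_
  infixl 7 _·_

  index-injective : ∀ {a b} → index a ≡ index b → a ≈ b
  index-injective {a} {b} eq =
    R.trans (R.sym (element-index a)) (R.trans (R.reflexive (cong element eq)) (element-index b))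

  opaque
    _≈?_ : Decidable₂ _≈_
    a ≈? b = map′ index-injective index-cong (index a Fin.≟ index b)

  -- Opaque, so that unification can solve for the summand.
  opaque
    ⨁ : (Fin n → Carrier) → Carrier
    ⨁ = ΣR.sum

    ⨁-suc : (f : Fin (suc n) → Carrier) → ⨁ f ≈ f zero ⊕ ⨁ (f ∘ suc)
    ⨁-suc f = R.refl

    ⨁-cong : {f g : Fin n → Carrier} → (∀ i → f i ≈ g i) → ⨁ f ≈ ⨁ g
    ⨁-cong = ΣR.sum-cong-≋

    ⨁-zero : {f : Fin n → Carrier} → (∀ i → f i ≈ 0#) → ⨁ f ≈ 0#
    ⨁-zero {n} f≈0 = R.trans (⨁-cong f≈0) (ΣR.sum-replicate-zero n)

    ⨁-+ : (f g : Fin n → Carrier) → (⨁ λ i → f i ⊕ g i) ≈ ⨁ f ⊕ ⨁ g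
    ⨁-+ = ΣR.∑-distrib-+

    ⨁-*ˡ : ∀ a (f : Fin n → Carrier) → a ⊗ ⨁ f ≈ ⨁ λ i → a ⊗ f i
    ⨁-*ˡ = ΣR.*-distribˡ-sum

    ⨁-*ʳ : ∀ a (f : Fin n → Carrier) → ⨁ f ⊗ a ≈ ⨁ λ i → f i ⊗ a
    ⨁-*ʳ = ΣR.*-distribʳ-sum

    ⨁-comm : (f : Fin m → Fin n → Carrier) → (⨁ λ i → ⨁ λ j → f i j) ≈ ⨁ λ j → ⨁ λ i → f i j
    ⨁-comm = ΣR.∑-comm

  ⨁-single : ∀ {f : Fin n → Carrier} j → (∀ i → i ≢ j → f i ≈ 0#) → ⨁ f ≈ f j
  ⨁-single zero    f≈0 = R.trans (⨁-suc _) (R.trans (R.+-congˡ (⨁-zero λ i → f≈0 (suc i) λ ())) (R.+-identityʳ _))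
  ⨁-single (suc j) f≈0 = R.trans (⨁-suc _) (R.trans
    (R.+-cong (f≈0 zero λ ()) (⨁-single j λ i i≢j → f≈0 (suc i) (i≢j ∘ Fin.suc-injective)))
    (R.+-identityˡ _))

  _·_ : (Fin m → Carrier) → (Fin m → Carrier) → Carrier
  v · σ = ⨁ λ l → v l ⊗ σ l

  ·-cong : {v w σ τ : Fin m → Carrier} → (∀ l → v l ≈ w l) → (∀ l → σ l ≈ τ l) → v · σ ≈ w · τ
  ·-cong v≈w σ≈τ = ⨁-cong λ l → R.*-cong (v≈w l) (σ≈τ l)

  ·-distribˡ : ∀ (v σ τ : Fin m → Carrier) → v · (λ l → σ l ⊕ τ l) ≈ (v · σ) ⊕ (v · τ)
  ·-distribˡ v σ τ = R.trans (⨁-cong λ l → R.distribˡ (v l) (σ l) (τ l)) (⨁-+ _ _)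

  ·-linearˡ : ∀ a (v w σ : Fin m → Carrier) → (λ l → v l ⊕ a ⊗ w l) · σ ≈ (v · σ) ⊕ a ⊗ (w · σ)
  ·-linearˡ a v w σ = begin
    (⨁ λ l → (v l ⊕ a ⊗ w l) ⊗ σ l)
      ≈⟨ ⨁-cong (λ l → R.trans (R.distribʳ (σ l) (v l) (a ⊗ w l)) (R.+-congˡ (R.*-assoc a (w l) (σ l)))) ⟩
    (⨁ λ l → v l ⊗ σ l ⊕ a ⊗ (w l ⊗ σ l))
      ≈⟨ ⨁-+ _ _ ⟩
    (v · σ) ⊕ (⨁ λ l → a ⊗ (w l ⊗ σ l))
      ≈⟨ R.+-congˡ (⨁-*ˡ a _) ⟨
    (v · σ) ⊕ a ⊗ (w · σ) ∎
    where open ≈-Reasoning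

  single : Fin m → Carrier → Fin m → Carrier
  single l α l′ = if does (l′ Fin.≟ l) then α else 0#

  single-at : ∀ (l : Fin m) α → single l α l ≈ α
  single-at l α with l Fin.≟ l
  ... | yes _  = R.refl
  ... | no l≢l = contradiction refl l≢l

  single-away : ∀ {l l′ : Fin m} α → l′ ≢ l → single l α l′ ≈ 0#
  single-away {l = l} {l′} α l′≢l with l′ Fin.≟ l
  ... | yes l′≡l = contradiction l′≡l l′≢l
  ... | no _     = R.refl

  ·-single : ∀ (v : Fin m → Carrier) l α → v · single l α ≈ v l ⊗ α
  ·-single v l α = R.trans
    (⨁-single l λ i i≢l → R.trans (R.*-congˡ (single-away α i≢l)) (R.zeroʳ (v i)))
    (R.*-congˡ (single-at l α))

  Dependent Onto : (Fin n → Fin m → Carrier) → Set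
  Dependent {n} v = ∃ λ (d : Fin n → Carrier) → (∃ λ i → ¬ d i ≈ 0#) × ∀ l → (⨁ λ i → d i ⊗ v i l) ≈ 0#
  Onto {n} {m} v = (y : Fin n → Carrier) → ∃ λ (τ : Fin m → Carrier) → ∀ i → v i · τ ≈ y i

  module Eliminate (v : Fin (suc n) → Fin m → Carrier) (l : Fin m) (pivot≉0 : ¬ v zero l ≈ 0#) where
    private
      b = proj₁ (inverse (v zero l) pivot≉0)
      b⊗pivot≈1 = proj₂ (inverse (v zero l) pivot≉0)

      h : Fin n → Carrier
      h i = ⊖ (v (suc i) l ⊗ b)

    reduced : Fin n → Fin m → Carrier
    reduced i l′ = v (suc i) l′ ⊕ h i ⊗ v zero l′

    reduced-pivot : ∀ i → reduced i l ≈ 0#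
    reduced-pivot i = begin
      x ⊕ (⊖ (x ⊗ b)) ⊗ v zero l ≈⟨ R.+-congˡ (R-ring.-‿distribˡ-* (x ⊗ b) (v zero l)) ⟨
      x ⊕ (⊖ (x ⊗ b ⊗ v zero l)) ≈⟨ R.+-congˡ (R.-‿cong (R.trans (R.*-assoc x b (v zero l)) (R.trans (R.*-congˡ b⊗pivot≈1) (R.*-identityʳ x)))) ⟩
      x ⊕ (⊖ x)                  ≈⟨ R.-‿inverseʳ x ⟩
      0#                         ∎
      where
      open ≈-Reasoning
      x = v (suc i) l

    dependent : Dependent reduced → Dependent v
    dependent (d , (i , dᵢ≉0) , Σ≈0) = d′ , (suc i , dᵢ≉0) , λ l′ → begin
      (⨁ λ i → d′ i ⊗ v i l′)
        ≈⟨ ⨁-suc _ ⟩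
      (⨁ λ i → d i ⊗ h i) ⊗ v zero l′ ⊕ (⨁ λ i → d i ⊗ v (suc i) l′)
        ≈⟨ R.+-comm _ _ ⟩
      (⨁ λ i → d i ⊗ v (suc i) l′) ⊕ (⨁ λ i → d i ⊗ h i) ⊗ v zero l′
        ≈⟨ R.+-congˡ (⨁-*ʳ (v zero l′) _) ⟩
      (⨁ λ i → d i ⊗ v (suc i) l′) ⊕ (⨁ λ i → d i ⊗ h i ⊗ v zero l′)
        ≈⟨ ⨁-+ _ _ ⟨
      (⨁ λ i → d i ⊗ v (suc i) l′ ⊕ d i ⊗ h i ⊗ v zero l′)
        ≈⟨ ⨁-cong (λ i → R.trans (R.+-congˡ (R.*-assoc (d i) (h i) (v zero l′))) (R.sym (R.distribˡ (d i) (v (suc i) l′) (h i ⊗ v zero l′)))) ⟩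
      (⨁ λ i → d i ⊗ reduced i l′)
        ≈⟨ Σ≈0 l′ ⟩
      0# ∎
      where
      open ≈-Reasoning
      d′ : Fin (suc n) → Carrier
      d′ zero    = ⨁ λ i → d i ⊗ h i
      d′ (suc i) = d i

    -- A solution of the reduced system with adjusted right-hand side is corrected at the pivot
    -- coordinate alone. The reduced rows vanish there and do not notice, while `α` is chosen to
    -- give the pivot row its value; the other rows then follow by undoing the elimination.
    onto : Onto reduced → Onto v
    onto reduced-onto y = τ , λ { zero → at-zero ; (suc i) → at-suc i }
      where
      open ≈-Reasoning
      τ′ = proj₁ (reduced-onto λ i → y (suc i) ⊕ h i ⊗ y zero)
      α = b ⊗ (y zero ⊕ (⊖ (v zero · τ′)))
      τ : Fin m → Carrier
      τ l′ = τ′ l′ ⊕ single l α l′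
      value : ∀ w → w · τ ≈ (w · τ′) ⊕ w l ⊗ α
      value w = R.trans (·-distribˡ w τ′ (single l α)) (R.+-congˡ (·-single w l α))
      at-zero : v zero · τ ≈ y zero
      at-zero = begin
        v zero · τ                                  ≈⟨ value (v zero) ⟩
        (v zero · τ′) ⊕ v zero l ⊗ α                ≈⟨ R.+-congˡ (R.*-assoc (v zero l) b _) ⟨
        (v zero · τ′) ⊕ v zero l ⊗ b ⊗ (y zero ⊕ (⊖ (v zero · τ′)))
          ≈⟨ R.+-congˡ (R.trans (R.*-congʳ (R.trans (R.*-comm (v zero l) b) b⊗pivot≈1)) (R.*-identityˡ _)) ⟩
        (v zero · τ′) ⊕ (y zero ⊕ (⊖ (v zero · τ′))) ≈⟨ R.+-comm _ _ ⟩
        y zero ⊕ (⊖ (v zero · τ′)) ⊕ (v zero · τ′)  ≈⟨ R.+-assoc _ _ _ ⟩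
        y zero ⊕ ((⊖ (v zero · τ′)) ⊕ (v zero · τ′)) ≈⟨ R.+-congˡ (R.-‿inverseˡ _) ⟩
        y zero ⊕ 0#                                 ≈⟨ R.+-identityʳ _ ⟩
        y zero                                      ∎
      at-suc : ∀ i → v (suc i) · τ ≈ y (suc i)
      at-suc i = R-group.∙-cancelʳ (h i ⊗ y zero) _ _ (begin
        (v (suc i) · τ) ⊕ h i ⊗ y zero          ≈⟨ R.+-congˡ (R.*-congˡ at-zero) ⟨
        (v (suc i) · τ) ⊕ h i ⊗ (v zero · τ)    ≈⟨ ·-linearˡ (h i) (v (suc i)) (v zero) τ ⟨
        reduced i · τ                           ≈⟨ value (reduced i) ⟩
        (reduced i · τ′) ⊕ reduced i l ⊗ α      ≈⟨ R.+-congˡ (R.trans (R.*-congʳ (reduced-pivot i)) (R.zeroˡ α)) ⟩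
        (reduced i · τ′) ⊕ 0#                   ≈⟨ R.+-identityʳ _ ⟩
        reduced i · τ′                          ≈⟨ proj₂ (reduced-onto λ i → y (suc i) ⊕ h i ⊗ y zero) i ⟩
        y (suc i) ⊕ h i ⊗ y zero                ∎)

  zero-dependent : (v : Fin (suc n) → Fin m → Carrier) → (∀ l → v zero l ≈ 0#) → Dependent v
  zero-dependent v v₀≈0 = (λ { zero → 1# ; (suc _) → 0# }) ,
    (zero , 1≉0) ,
    λ l → R.trans (⨁-suc _) (R.trans
      (R.+-cong (R.trans (R.*-identityˡ _) (v₀≈0 l)) (⨁-zero λ i → R.zeroˡ (v (suc i) l))) (R.+-identityˡ 0#))

  -- Elimination row by row: a zero row is itself a dependency, and otherwise a pivot clears its
  -- column from the remaining rows. Surjectivity is the useful form of independence here, since it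
  -- supplies the translations between fibres.
  dependent⊎onto : ∀ n (v : Fin n → Fin m → Carrier) → Dependent v ⊎ Onto v
  dependent⊎onto zero    v = inj₂ λ y → (λ _ → 0#) , λ ()
  dependent⊎onto (suc n) v with any? (λ l → ¬? (v zero l ≈? 0#))
  ... | no v₀≉0  = inj₁ (zero-dependent v λ l → decidable-stable (v zero l ≈? 0#) λ ≉0 → v₀≉0 (l , ≉0))
  ... | yes (l , pivot≉0) with dependent⊎onto n (Eliminate.reduced v l pivot≉0)
  ...   | inj₁ dep  = inj₁ (Eliminate.dependent v l pivot≉0 dep)
  ...   | inj₂ onto = inj₂ (Eliminate.onto v l pivot≉0 onto)

  -- Uniform vectors and the fibres of a linear map

  vec : Fin (q ^ m) → Fin m → Carrier
  vec {m} σ l = element (finToFun {q} {m} σ l)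

  unvec : (Fin m → Carrier) → Fin (q ^ m)
  unvec v = funToFin (index ∘ v)

  vec-unvec : ∀ (v : Fin m → Carrier) l → vec {m} (unvec v) l ≈ v l
  vec-unvec v l = R.trans (R.reflexive (cong element (finToFun-funToFin (index ∘ v) l))) (element-index (v l))

  unvec-vec : ∀ (σ : Fin (q ^ m)) {v} → (∀ l → v l ≈ vec {m} σ l) → unvec v ≡ σ
  unvec-vec {m} σ v≈σ = trans
    (funToFin-cong m λ l → trans (index-cong (v≈σ l)) (index-element (finToFun {q} {m} σ l)))
    (funToFin-finToFin {m} {q} σ)

  translation : (Fin m → Carrier) → Permutation′ (q ^ m)
  translation {m} τ = permutation (shift τ) (shift (λ l → ⊖ τ l))
    (λ σ → shift-shift (λ l → ⊖ τ l) τ (λ l → R.-‿inverseˡ (τ l)) σ)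
    (λ σ → shift-shift τ (λ l → ⊖ τ l) (λ l → R.-‿inverseʳ (τ l)) σ)
    where
    shift : (Fin m → Carrier) → Fin (q ^ m) → Fin (q ^ m)
    shift τ σ = unvec λ l → vec {m} σ l ⊕ τ l
    shift-shift : ∀ τ τ′ → (∀ l → τ l ⊕ τ′ l ≈ 0#) → ∀ σ → shift τ′ (shift τ σ) ≡ σ
    shift-shift τ τ′ inv σ = unvec-vec σ λ l →
      R.trans (R.+-congʳ (vec-unvec _ l)) (R.trans (R.+-assoc _ _ _)
        (R.trans (R.+-congˡ (inv l)) (R.+-identityʳ _)))

  values : (Fin n → Fin m → Carrier) → Fin (q ^ m) → Fin n → Fin q
  values {m = m} v σ i = index (v i · vec {m} σ)

  fibre? : ∀ (v : Fin n → Fin m → Carrier) (y : Fin n → Fin q) → Decidable (λ (σ : Fin (q ^ m)) → ∀ i → values v σ i ≡ y i)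
  fibre? v y σ = all? λ i → values v σ i Fin.≟ y i

  -- Choose τ with image z - y. Adding τ permutes the seeds and carries the fibre over y onto the
  -- fibre over z.
  size-fibre-translate : (v : Fin n → Fin m → Carrier) → Onto v → ∀ y z → size (fibre? v y) ≡ size (fibre? v z)
  size-fibre-translate {n} {m} v onto y z = sym (trans
    (sum-permute (λ σ → 𝟙 (fibre? v z σ)) π)
    (sum-cong-≗ {q ^ m} λ σ → 𝟙-cong (fibre? v z (π ⟨$⟩ʳ σ)) (fibre? v y σ)
      (λ at-z i → trans (index-cong (cancel σ i (index-injective (trans (at-z i) (sym (index-element (z i))))))) (index-element (y i)))
      (λ at-y i → trans (index-cong (shifted σ i (index-injective (trans (at-y i) (sym (index-element (y i))))))) (index-element (z i)))))
    where
    open ≈-Reasoning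
    w : Fin n → Carrier
    w i = element (z i) ⊕ (⊖ element (y i))
    τ = proj₁ (onto w)
    π = translation τ
    moved : ∀ σ i → v i · vec {m} (π ⟨$⟩ʳ σ) ≈ (v i · vec {m} σ) ⊕ w i
    moved σ i = begin
      v i · vec {m} (π ⟨$⟩ʳ σ)         ≈⟨ ·-cong (λ _ → R.refl) (vec-unvec _) ⟩
      v i · (λ l → vec {m} σ l ⊕ τ l)  ≈⟨ ·-distribˡ (v i) (vec {m} σ) τ ⟩
      (v i · vec {m} σ) ⊕ (v i · τ)    ≈⟨ R.+-congˡ (proj₂ (onto w) i) ⟩
      (v i · vec {m} σ) ⊕ w i          ∎
    y⊕w≈z : ∀ i → element (y i) ⊕ w i ≈ element (z i)
    y⊕w≈z i = begin
      element (y i) ⊕ (element (z i) ⊕ (⊖ element (y i))) ≈⟨ R.+-comm _ _ ⟩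
      element (z i) ⊕ (⊖ element (y i)) ⊕ element (y i)   ≈⟨ R.+-assoc _ _ _ ⟩
      element (z i) ⊕ ((⊖ element (y i)) ⊕ element (y i)) ≈⟨ R.+-congˡ (R.-‿inverseˡ _) ⟩
      element (z i) ⊕ 0#                                  ≈⟨ R.+-identityʳ _ ⟩
      element (z i)                                       ∎
    shifted : ∀ σ i → v i · vec {m} σ ≈ element (y i) → v i · vec {m} (π ⟨$⟩ʳ σ) ≈ element (z i)
    shifted σ i at-y = R.trans (moved σ i) (R.trans (R.+-congʳ at-y) (y⊕w≈z i))
    cancel : ∀ σ i → v i · vec {m} (π ⟨$⟩ʳ σ) ≈ element (z i) → v i · vec {m} σ ≈ element (y i)
    cancel σ i at-z = R-group.∙-cancelʳ (w i) _ _
      (R.trans (R.sym (moved σ i)) (R.trans at-z (R.sym (y⊕w≈z i))))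

  sum-fibres : (v : Fin n → Fin m → Carrier) → ∑[ y < q ^ n ] size (fibre? v (finToFun {q} {n} y)) ≡ q ^ m
  sum-fibres {n} {m} v = begin
    ∑[ y < q ^ n ] size (fibre? v (finToFun {q} {n} y))
      ≡⟨ ∑-comm {q ^ n} {q ^ m} _ ⟩
    ∑[ σ < q ^ m ] ∑[ y < q ^ n ] 𝟙 (fibre? v (finToFun {q} {n} y) σ)
      ≡⟨ sum-cong-≗ {q ^ m} one-fibre ⟩
    ∑[ σ < q ^ m ] 1
      ≡⟨ trans (sum-const (q ^ m) 1) (*-identityʳ (q ^ m)) ⟩
    q ^ m ∎
    where
    open ≡-Reasoning
    one-fibre : ∀ σ → ∑[ y < q ^ n ] 𝟙 (fibre? v (finToFun {q} {n} y) σ) ≡ 1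
    one-fibre σ = begin
      ∑[ y < q ^ n ] 𝟙 (fibre? v (finToFun {q} {n} y) σ)
        ≡⟨ sum-cong-≗ {q ^ n} (λ y → 𝟙-all (λ i → values v σ i Fin.≟ finToFun {q} {n} y i)) ⟩
      ∑[ y < q ^ n ] product (λ i → 𝟙 (values v σ i Fin.≟ finToFun {q} {n} y i))
        ≡⟨ sum-product n (λ i b → 𝟙 (values v σ i Fin.≟ b)) ⟩
      product (λ i → size (values v σ i Fin.≟_))
        ≡⟨ product-cong (λ i → size-≟ (values v σ i)) ⟩
      product {n} (λ _ → 1)
        ≡⟨ trans (product-const n 1) (^-zeroˡ n) ⟩
      1 ∎

  -- The qⁿ fibres partition the seeds and are equally large. Read as a statement about a uniform
  -- seed, this is uniformity and independence of the n values at once.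
  size-fibre : (v : Fin n → Fin m → Carrier) → Onto v → ∀ y → q ^ n * size (fibre? v y) ≡ q ^ m
  size-fibre {n} {m} v onto y = begin
    q ^ n * size (fibre? v y)
      ≡⟨ sum-const (q ^ n) (size (fibre? v y)) ⟨
    ∑[ z < q ^ n ] size (fibre? v y)
      ≡⟨ sum-cong-≗ {q ^ n} (λ z → size-fibre-translate v onto y (finToFun {q} {n} z)) ⟩
    ∑[ z < q ^ n ] size (fibre? v (finToFun {q} {n} z))
      ≡⟨ sum-fibres v ⟩
    q ^ m ∎
    where open ≡-Reasoning

-- Random coefficients on the edges of the graph

sum-mono-gap : ∀ {f h : Fin n → ℕ} {x} → (∀ i → f i ≤ h i) → ∀ i → f i + x ≤ h i → sum f + x ≤ sum h
sum-mono-gap {f = f} {x = x} f≤h zero gap = ≤-trans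
  (≤-reflexive (trans (+-assoc (f zero) (sum (f ∘ suc)) x) (trans (cong (f zero +_) (+-comm (sum (f ∘ suc)) x)) (sym (+-assoc (f zero) x _)))))
  (+-mono-≤ gap (sum-mono (f≤h ∘ suc)))
sum-mono-gap {f = f} {x = x} f≤h (suc i) gap = ≤-trans
  (≤-reflexive (+-assoc (f zero) (sum (f ∘ suc)) x))
  (+-mono-≤ (f≤h zero) (sum-mono-gap (f≤h ∘ suc) i gap))

module Coefficients {q : ℕ} (F : FiniteField q)
  {u s t n : ℕ} .{{_ : NonZero u}} (3u≤q : 3 * u ≤ q) (g : Fin u → Fin t → Fin s)
  (expands : ∀ {S} (S? : Decidable S) → size S? ≤ n → 2 * size S? ≤ size (neighbour? g S?)) where
  open FiniteField F
  open LinearAlgebra F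
  private module R = CommutativeRing commutativeRing

  adjacent? : ∀ x l → Dec (∃ λ j → g x j ≡ l)
  adjacent? x l = any? λ j → g x j Fin.≟ l

  -- Erasing the non-edges in c instead of in the matrix lets the random column range over all of
  -- Fᵘ, so the columns remain uniform and independent.
  mask : Fin s → (Fin u → Carrier) → Fin u → Carrier
  mask l c x = if does (adjacent? x l) then c x else 0#

  mask-cong : ∀ l {c d} → (∀ x → c x ≈ d x) → ∀ x → mask l c x ≈ mask l d x
  mask-cong l c≈d x with does (adjacent? x l)
  ... | true  = c≈d x
  ... | false = R.refl

  support? : (c : Fin u → Carrier) → Decidable (λ x → ¬ c x ≈ 0#)
  support? c x = ¬? (c x ≈? 0#)

  private
    instance
      q≢0 : NonZero q
      q≢0 = >-nonZero (≤-trans (>-nonZero⁻¹ u) (≤-trans (m≤m+n u _) 3u≤q))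

    onto₁ : ∀ {b : Fin u → Carrier} x → ¬ b x ≈ 0# → Onto {1} (λ _ → b)
    onto₁ {b} x bₓ≉0 y = single x (c ⊗ y zero) , λ { zero → begin
      b · single x (c ⊗ y zero)  ≈⟨ ·-single b x (c ⊗ y zero) ⟩
      b x ⊗ (c ⊗ y zero)         ≈⟨ R.*-assoc (b x) c (y zero) ⟨
      b x ⊗ c ⊗ y zero           ≈⟨ R.*-congʳ (R.trans (R.*-comm (b x) c) (proj₂ (inverse (b x) bₓ≉0))) ⟩
      1# ⊗ y zero                ≈⟨ R.*-identityˡ (y zero) ⟩
      y zero                     ∎ }
      where
      open Relation.Binary.Reasoning.Setoid R.setoid
      c = proj₁ (inverse (b x) bₓ≉0)

    kernel : (Fin u → Carrier) → ℕ
    kernel b = ∑[ a < q ^ u ] 𝟙 (b · vec {u} a ≈? 0#)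

    kernel≤ : ∀ b → kernel b ≤ q ^ u
    kernel≤ b = ≤-trans (sum-mono {q ^ u} λ a → 𝟙≤1 (b · vec {u} a ≈? 0#))
      (≤-reflexive (trans (sum-const (q ^ u) 1) (*-identityʳ (q ^ u))))

    -- A nonzero linear form is onto, so a uniform column is annihilated with probability exactly
    -- 1/q.
    kernel-nonzero : ∀ b x → ¬ b x ≈ 0# → kernel b * q ≡ q ^ u
    kernel-nonzero b x bₓ≉0 = begin
      kernel b * q
        ≡⟨ cong (_* q) (sum-cong-≗ {q ^ u} λ a → 𝟙-cong (b · vec {u} a ≈? 0#) (fibre? {1} (λ _ → b) (λ _ → index 0#) a)
             (λ ≈0 _ → index-cong ≈0) (λ at-0 → index-injective (at-0 zero))) ⟩
      size (fibre? {1} (λ _ → b) (λ _ → index 0#)) * q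
        ≡⟨ *-comm _ q ⟩
      q * size (fibre? {1} (λ _ → b) (λ _ → index 0#))
        ≡⟨ cong (_* size (fibre? {1} (λ _ → b) (λ _ → index 0#))) (*-identityʳ q) ⟨
      q ^ 1 * size (fibre? {1} (λ _ → b) (λ _ → index 0#))
        ≡⟨ size-fibre {1} (λ _ → b) (onto₁ x bₓ≉0) (λ _ → index 0#) ⟩
      q ^ u ∎
      where open ≡-Reasoning

    -- A cell adjacent to the support of c sees a nonzero masked vector and gains a factor 1/q; at
    -- every other cell the trivial bound is used.
    kernels≤ : ∀ c → product (λ l → kernel (mask l c)) * q ^ size (neighbour? g (support? c)) ≤ (q ^ u) ^ s
    kernels≤ c = begin
      product (λ l → kernel (mask l c)) * q ^ size Γ?
        ≡⟨ cong (product (λ l → kernel (mask l c)) *_) (product-if-1 Γ? q) ⟨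
      product (λ l → kernel (mask l c)) * product (λ l → if does (Γ? l) then q else 1)
        ≡⟨ product-distrib-* (λ l → kernel (mask l c)) (λ l → if does (Γ? l) then q else 1) ⟨
      product (λ l → kernel (mask l c) * (if does (Γ? l) then q else 1))
        ≤⟨ product-mono column ⟩
      product {s} (λ _ → q ^ u)
        ≡⟨ product-const s (q ^ u) ⟩
      (q ^ u) ^ s ∎
      where
      open ≤-Reasoning
      Γ? = neighbour? g (support? c)
      column : ∀ l → kernel (mask l c) * (if does (Γ? l) then q else 1) ≤ q ^ u
      column l with Γ? l
      ... | no _ = ≤-trans (≤-reflexive (*-identityʳ _)) (kernel≤ (mask l c))
      ... | yes (x , cₓ≉0 , adj) = ≤-reflexive (kernel-nonzero (mask l c) x masked≉0)
        where
        masked≉0 : ¬ mask l c x ≈ 0#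
        masked≉0 with adjacent? x l
        ... | yes _ = cₓ≉0
        ... | no ¬adj = contradiction adj ¬adj

    -- This is q⁻²ᶻ for a vector with z nonzero entries, scaled by (q²)ᵘ to be an integer.
    weight : (Fin u → Carrier) → ℕ
    weight c = product (λ x → if does (support? c x) then 1 else q * q)

    -- Expansion enters here: the exponent of q in `kernels≤` is at least twice the support.
    kernels-weight : ∀ c → size (support? c) ≤ n →
      product (λ l → kernel (mask l c)) * (q * q) ^ u ≤ (q ^ u) ^ s * weight c
    kernels-weight c small = begin
      κ * (q * q) ^ u                          ≡⟨ cong (κ *_) (trans (product-if (support? c) (q * q) 1) (trans (cong ((q * q) ^ u *_) (^-zeroˡ z)) (*-identityʳ _))) ⟨
      κ * (weight c * (q * q) ^ z)             ≡⟨ swap κ (weight c) ((q * q) ^ z) ⟩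
      κ * (q * q) ^ z * weight c               ≡⟨ cong (λ x → κ * x * weight c) (trans (cong (λ x → (q * x) ^ z) (sym (*-identityʳ q))) (^-*-assoc q 2 z)) ⟩
      κ * q ^ (2 * z) * weight c               ≤⟨ *-monoˡ-≤ (weight c) (*-monoʳ-≤ κ (^-monoʳ-≤ q (expands (support? c) small))) ⟩
      κ * q ^ size (neighbour? g (support? c)) * weight c
                                               ≤⟨ *-monoˡ-≤ (weight c) (kernels≤ c) ⟩
      (q ^ u) ^ s * weight c                   ∎
      where
      open ≤-Reasoning
      κ = product (λ l → kernel (mask l c))
      z = size (support? c)
      swap : ∀ a b c → a * (b * c) ≡ a * c * b
      swap = solve-∀

    sum-weight : ∑[ C < q ^ u ] weight (vec {u} C) ≤ (q + q * q) ^ u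
    sum-weight = begin
      ∑[ C < q ^ u ] weight (vec {u} C)
        ≡⟨ sum-product {q} u (λ _ b → if does (¬? (element b ≈? 0#)) then 1 else q * q) ⟩
      product {u} (λ _ → ∑[ b < q ] (if does (¬? (element b ≈? 0#)) then 1 else q * q))
        -- The zero entry is given `1 + q * q` in place of `q * q`, which rounds q - 1 + q² up to q
        -- + q² and avoids subtraction.
        ≤⟨ product-mono {u} (λ _ → sum-mono entry) ⟩
      product {u} (λ _ → ∑[ b < q ] (1 + 𝟙 (index 0# Fin.≟ b) * (q * q)))
        ≡⟨ product-const u _ ⟩
      (∑[ b < q ] (1 + 𝟙 (index 0# Fin.≟ b) * (q * q))) ^ u
        ≡⟨ cong (_^ u) (trans (∑-distrib-+ {q} (λ _ → 1) _) (cong₂ _+_ (trans (sum-const q 1) (*-identityʳ q))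
             (trans (sym (*-distribʳ-sum {q} (q * q) _)) (trans (cong (_* (q * q)) (size-≟ (index 0#))) (*-identityˡ (q * q)))))) ⟩
      (q + q * q) ^ u ∎
      where
      open ≤-Reasoning
      entry : ∀ b → (if does (¬? (element b ≈? 0#)) then 1 else q * q) ≤ 1 + 𝟙 (index 0# Fin.≟ b) * (q * q)
      entry b with element b ≈? 0#
      ... | no _   = s≤s z≤n
      ... | yes ≈0 rewrite 𝟙-yes (index 0# Fin.≟ b) (trans (index-cong (R.sym ≈0)) (index-element b)) =
        ≤-trans (≤-reflexive (sym (*-identityˡ (q * q)))) (n≤1+n _)

    nonzero? : (c : Fin u → Carrier) → Dec (∃ λ x → ¬ c x ≈ 0#)
    nonzero? c = any? (support? c)

    -- The vector c = 0 alone contributes (q²)ᵘ to `sum-weight`; it is annihilated by every matrix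
    -- and has to be left out of the union bound.
    sum-weight-nonzero : ∑[ C < q ^ u ] (𝟙 (nonzero? (vec {u} C)) * weight (vec {u} C)) + (q * q) ^ u ≤ (q + q * q) ^ u
    sum-weight-nonzero = ≤-trans
      (sum-mono-gap {q ^ u} (λ C → 𝟙-*-≤ (nonzero? (vec {u} C)) λ _ → ≤-refl) O
        (≤-reflexive (cong₂ _+_ (cong (_* weight (vec {u} O)) (𝟙-no (nonzero? (vec {u} O)) λ (x , ≉0) → ≉0 (O≈0 x))) (sym weight-O))))
      sum-weight
      where
      O = unvec {u} (λ _ → 0#)
      O≈0 : ∀ x → vec {u} O x ≈ 0#
      O≈0 = vec-unvec {u} (λ _ → 0#)
      weight-O : weight (vec {u} O) ≡ (q * q) ^ u
      weight-O = trans (product-cong entry) (product-const u (q * q))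
        where
        entry : ∀ x → (if does (support? (vec {u} O) x) then 1 else q * q) ≡ q * q
        entry x with vec {u} O x ≈? 0#
        ... | yes _ = refl
        ... | no ≉0 = contradiction (O≈0 x) ≉0

    N : ℕ
    N = (q ^ u) ^ s

    column : Fin N → Fin s → Fin u → Carrier
    column ω l = vec {u} (finToFun {q ^ u} {s} ω l)

    Bad : Fin N → Fin (q ^ u) → Set
    Bad ω C = (∃ λ x → ¬ vec {u} C x ≈ 0#) × size (support? (vec {u} C)) ≤ n ×
      (∀ l → mask l (vec {u} C) · column ω l ≈ 0#)

    killed? : ∀ ω C → Dec (∀ l → mask l (vec {u} C) · column ω l ≈ 0#)
    killed? ω C = all? λ l → mask l (vec {u} C) · column ω l ≈? 0#

    small? : ∀ C → Dec (size (support? (vec {u} C)) ≤ n)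
    small? C = size (support? (vec {u} C)) ≤? n

    bad? : ∀ ω C → Dec (Bad ω C)
    bad? ω C = nonzero? (vec {u} C) ×-dec small? C ×-dec killed? ω C

    sum-killed : ∀ C → ∑[ ω < N ] 𝟙 (killed? ω C) ≡ product (λ l → kernel (mask l (vec {u} C)))
    sum-killed C = trans
      (sum-cong-≗ {N} λ ω → 𝟙-all (λ l → mask l (vec {u} C) · column ω l ≈? 0#))
      (sum-product {q ^ u} s λ l a → 𝟙 (mask l (vec {u} C) · vec {u} a ≈? 0#))

    sum-bad≤ : ∀ C → (∑[ ω < N ] 𝟙 (bad? ω C)) * (q * q) ^ u ≤ N * (𝟙 (nonzero? (vec {u} C)) * weight (vec {u} C))
    sum-bad≤ C = begin
      (∑[ ω < N ] 𝟙 (bad? ω C)) * Q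
        ≡⟨ cong (_* Q) (sum-cong-≗ {N} λ ω → trans (𝟙-× a? (b? ×-dec killed? ω C)) (cong (𝟙 a? *_) (𝟙-× b? (killed? ω C)))) ⟩
      (∑[ ω < N ] (𝟙 a? * (𝟙 b? * 𝟙 (killed? ω C)))) * Q
        ≡⟨ cong (_* Q) (trans (cong (𝟙 a? *_) (*-distribˡ-sum {N} (𝟙 b?) _)) (*-distribˡ-sum {N} (𝟙 a?) _)) ⟨
      𝟙 a? * (𝟙 b? * (∑[ ω < N ] 𝟙 (killed? ω C))) * Q
        ≡⟨ cong (λ x → 𝟙 a? * (𝟙 b? * x) * Q) (sum-killed C) ⟩
      𝟙 a? * (𝟙 b? * product (λ l → kernel (mask l (vec {u} C)))) * Q
        ≡⟨ reassoc (𝟙 a?) (𝟙 b?) _ Q ⟩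
      𝟙 a? * (𝟙 b? * (product (λ l → kernel (mask l (vec {u} C))) * Q))
        ≤⟨ *-monoʳ-≤ (𝟙 a?) (𝟙-*-≤ b? (kernels-weight (vec {u} C))) ⟩
      𝟙 a? * (N * weight (vec {u} C))
        ≡⟨ swap (𝟙 a?) N (weight (vec {u} C)) ⟩
      N * (𝟙 a? * weight (vec {u} C)) ∎
      where
      open ≤-Reasoning
      a? = nonzero? (vec {u} C)
      b? = small? C
      Q = (q * q) ^ u
      reassoc : ∀ a b c d → a * (b * c) * d ≡ a * (b * (c * d))
      reassoc = solve-∀
      swap : ∀ a b c → a * (b * c) ≡ b * (a * c)
      swap = solve-∀

    -- With the term of c = 0 added to both sides, the claim is (1 + 1/q)ᵘ < 2. This needs 2u < q,
    -- which is where 3u ≤ q comes from.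
    sum-bad< : ∑[ ω < N ] ∑[ C < q ^ u ] 𝟙 (bad? ω C) < N
    sum-bad< = *-cancelʳ-< Q _ _ (+-cancelʳ-< (N * Q) _ _ (begin-strict
      (∑[ ω < N ] ∑[ C < q ^ u ] 𝟙 (bad? ω C)) * Q + N * Q
        ≡⟨ cong (λ x → x * Q + N * Q) (∑-comm {N} {q ^ u} λ ω C → 𝟙 (bad? ω C)) ⟩
      (∑[ C < q ^ u ] ∑[ ω < N ] 𝟙 (bad? ω C)) * Q + N * Q
        ≡⟨ cong (_+ N * Q) (*-distribʳ-sum {q ^ u} Q _) ⟩
      ∑[ C < q ^ u ] ((∑[ ω < N ] 𝟙 (bad? ω C)) * Q) + N * Q
        ≤⟨ +-monoˡ-≤ (N * Q) (sum-mono {q ^ u} sum-bad≤) ⟩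
      ∑[ C < q ^ u ] (N * (𝟙 (nonzero? (vec {u} C)) * weight (vec {u} C))) + N * Q
        ≡⟨ cong (_+ N * Q) (*-distribˡ-sum {q ^ u} N _) ⟨
      N * ∑[ C < q ^ u ] (𝟙 (nonzero? (vec {u} C)) * weight (vec {u} C)) + N * Q
        ≡⟨ *-distribˡ-+ N _ Q ⟨
      N * (∑[ C < q ^ u ] (𝟙 (nonzero? (vec {u} C)) * weight (vec {u} C)) + Q)
        ≤⟨ *-monoʳ-≤ N sum-weight-nonzero ⟩
      N * (q + q * q) ^ u
        ≡⟨ cong (λ x → N * x ^ u) (*-suc q q) ⟨
      N * (q * suc q) ^ u
        ≡⟨ cong (N *_) (^-distribʳ-* u q (suc q)) ⟩
      N * (q ^ u * suc q ^ u)
        <⟨ *-monoʳ-< N {{m^n≢0 (q ^ u) s {{m^n≢0 q u}}}} (*-monoʳ-< (q ^ u) {{m^n≢0 q u}} ([1+m]^j<2*m^j q u 2u<q)) ⟩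
      N * (q ^ u * (2 * q ^ u))
        ≡⟨ double N (q ^ u) ⟩
      N * (q ^ u * q ^ u) + N * (q ^ u * q ^ u)
        ≡⟨ cong (λ x → N * x + N * x) (^-distribʳ-* u q q) ⟨
      N * Q + N * Q ∎))
      where
      open ≤-Reasoning
      Q = (q * q) ^ u
      2u<q : 2 * u < q
      2u<q = <-≤-trans (*-monoˡ-< u {2} {3} ≤-refl) 3u≤q
      double : ∀ a b → a * (b * (2 * b)) ≡ a * (b * b) + a * (b * b)
      double = solve-∀

    good : ∃ λ ω → ∑[ C < q ^ u ] 𝟙 (bad? ω C) ≡ 0
    good = sum<n⇒∃zero (λ ω → ∑[ C < q ^ u ] 𝟙 (bad? ω C)) sum-bad<

  -- Opaque for the same reason as expander.
  opaque
    coefficients : ∃ λ (a : Fin s → Fin u → Carrier) → ∀ c → (∃ λ x → ¬ c x ≈ 0#) →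
      size (support? c) ≤ n → ¬ (∀ l → mask l c · a l ≈ 0#)
    coefficients = column ω , λ c (x , cₓ≉0) small killed → contradiction (begin-strict
      0                                <⟨ s≤s z≤n ⟩
      1                                ≡⟨ 𝟙-yes (bad? ω (unvec c))
        ( (x , λ ≈0 → cₓ≉0 (R.trans (R.sym (vec-unvec c x)) ≈0))
        , ≤-trans (size-mono (support? (vec {u} (unvec c))) (support? c)
            (λ x ≉0 ≈0 → ≉0 (R.trans (vec-unvec c x) ≈0))) small
        , λ l → R.trans (·-cong (mask-cong l (vec-unvec c)) (λ _ → R.refl)) (killed l)) ⟨
      𝟙 (bad? ω (unvec c))             ≤⟨ term≤sum {q ^ u} (λ C → 𝟙 (bad? ω C)) (unvec c) ⟩
      ∑[ C < q ^ u ] 𝟙 (bad? ω C)      ≡⟨ proj₂ good ⟩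
      0                                ∎) λ ()
      where
      open ≤-Reasoning
      ω : Fin N
      ω = proj₁ good

-- The field of integers modulo a prime

module IntegersModulo (p : ℕ) (p-prime : Prime p) where
  open import Data.Integer.Base using (+_)

  private instance
    p≢0 : NonZero p
    p≢0 = prime⇒nonZero p-prime

  infix 4 _≈_

  -- The quotient is kept as data: matching on the equation turns each congruence law into a
  -- polynomial identity for the ring solver.
  record _≈_ (a b : ℤ) : Set where
    constructor mod
    field
      multiple : ℤ
      equation : a ≡ b ℤ.+ multiple ℤ.* + p

  reflexive : ∀ {a b} → a ≡ b → a ≈ b
  reflexive {a} refl = mod (+ 0) (sym (ℤ.+-identityʳ a))

  ≈-sym : ∀ {a b} → a ≈ b → b ≈ a
  ≈-sym {b = b} (mod k refl) = mod (ℤ.- k) (identity b k (+ p))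
    where
    identity : ∀ b k p → b ≡ b ℤ.+ k ℤ.* p ℤ.+ (ℤ.- k) ℤ.* p
    identity = ℤSolver.solve-∀

  ≈-trans : ∀ {a b c} → a ≈ b → b ≈ c → a ≈ c
  ≈-trans {c = c} (mod k refl) (mod l refl) = mod (l ℤ.+ k) (identity c k l (+ p))
    where
    identity : ∀ c k l p → c ℤ.+ l ℤ.* p ℤ.+ k ℤ.* p ≡ c ℤ.+ (l ℤ.+ k) ℤ.* p
    identity = ℤSolver.solve-∀

  +-cong : ∀ {a b c d} → a ≈ b → c ≈ d → a ℤ.+ c ≈ b ℤ.+ d
  +-cong {b = b} {d = d} (mod k refl) (mod l refl) = mod (k ℤ.+ l) (identity b d k l (+ p))
    where
    identity : ∀ b d k l p → b ℤ.+ k ℤ.* p ℤ.+ (d ℤ.+ l ℤ.* p) ≡ b ℤ.+ d ℤ.+ (k ℤ.+ l) ℤ.* p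
    identity = ℤSolver.solve-∀

  *-cong : ∀ {a b c d} → a ≈ b → c ≈ d → a ℤ.* c ≈ b ℤ.* d
  *-cong {b = b} {d = d} (mod k refl) (mod l refl) =
    mod (b ℤ.* l ℤ.+ k ℤ.* d ℤ.+ k ℤ.* l ℤ.* + p) (identity b d k l (+ p))
    where
    identity : ∀ b d k l p → (b ℤ.+ k ℤ.* p) ℤ.* (d ℤ.+ l ℤ.* p) ≡ b ℤ.* d ℤ.+ (b ℤ.* l ℤ.+ k ℤ.* d ℤ.+ k ℤ.* l ℤ.* p) ℤ.* p
    identity = ℤSolver.solve-∀

  neg-cong : ∀ {a b} → a ≈ b → ℤ.- a ≈ ℤ.- b
  neg-cong {b = b} (mod k refl) = mod (ℤ.- k) (identity b k (+ p))
    where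
    identity : ∀ b k p → ℤ.- (b ℤ.+ k ℤ.* p) ≡ (ℤ.- b) ℤ.+ (ℤ.- k) ℤ.* p
    identity = ℤSolver.solve-∀

  isCommutativeRing : IsCommutativeRing _≈_ ℤ._+_ ℤ._*_ ℤ.-_ (+ 0) (+ 1)
  isCommutativeRing = record
    { isRing = record
      { +-isAbelianGroup = record
        { isGroup = record
          { isMonoid = record
            { isSemigroup = record
              { isMagma = record
                { isEquivalence = record { refl = reflexive refl ; sym = ≈-sym ; trans = ≈-trans }
                ; ∙-cong = +-cong
                }
              ; assoc = λ a b c → reflexive (ℤ.+-assoc a b c)
              }
            ; identity = (λ a → reflexive (ℤ.+-identityˡ a)) , λ a → reflexive (ℤ.+-identityʳ a)
            }
          ; inverse = (λ a → reflexive (ℤ.+-inverseˡ a)) , λ a → reflexive (ℤ.+-inverseʳ a)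
          ; ⁻¹-cong = neg-cong
          }
        ; comm = λ a b → reflexive (ℤ.+-comm a b)
        }
      ; *-cong = *-cong
      ; *-assoc = λ a b c → reflexive (ℤ.*-assoc a b c)
      ; *-identity = (λ a → reflexive (ℤ.*-identityˡ a)) , λ a → reflexive (ℤ.*-identityʳ a)
      ; distrib = (λ a b c → reflexive (ℤ.*-distribˡ-+ a b c)) , λ a b c → reflexive (ℤ.*-distribʳ-+ a b c)
      }
    ; *-comm = λ a b → reflexive (ℤ.*-comm a b)
    }

  -- The distance between two residues is a multiple of p and less than p.
  residue-unique : ∀ {m n} → m < p → n < p → + m ≈ + n → m ≡ n
  residue-unique {m} {n} m<p n<p (mod k eq) with ∣ m - n ∣ in distance
  ... | zero  = ∣m-n∣≡0⇒m≡n distance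
  ... | suc d = contradiction (divides ℤ.∣ k ∣ (begin
    suc d                    ≡⟨ distance ⟨
    ∣ m - n ∣                ≡⟨ abs-⊖ m n ⟨
    ℤ.∣ m ℤ.⊖ n ∣            ≡⟨ cong ℤ.∣_∣ (ℤ.m-n≡m⊖n m n) ⟨
    ℤ.∣ + m ℤ.- + n ∣        ≡⟨ cong (λ a → ℤ.∣ a ℤ.- + n ∣) eq ⟩
    ℤ.∣ + n ℤ.+ k ℤ.* + p ℤ.- + n ∣ ≡⟨ cong ℤ.∣_∣ (cancel (+ n) (k ℤ.* + p)) ⟩
    ℤ.∣ k ℤ.* + p ∣          ≡⟨ ℤ.abs-* k (+ p) ⟩
    ℤ.∣ k ∣ * p              ∎))
    (>⇒∤ (≤-<-trans (≤-trans (≤-reflexive (sym distance)) (∣m-n∣≤m⊔n m n)) (⊔-lub m<p n<p)))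
    where
    open ≡-Reasoning
    cancel : ∀ a b → a ℤ.+ b ℤ.- a ≡ b
    cancel = ℤSolver.solve-∀
    abs-⊖ : ∀ m n → ℤ.∣ m ℤ.⊖ n ∣ ≡ ∣ m - n ∣
    abs-⊖ m n with ≤-total m n
    ... | inj₁ m≤n = trans (ℤ.∣⊖∣-≤ m≤n) (sym (m≤n⇒∣m-n∣≡n∸m m≤n))
    ... | inj₂ n≤m = trans (ℤ.∣m⊖n∣≡∣n⊖m∣ m n) (trans (ℤ.∣⊖∣-≤ n≤m) (sym (m≤n⇒∣n-m∣≡n∸m n≤m)))

  %-≈ : ∀ a → + (a ℤ.%ℕ p) ≈ a
  %-≈ a = ≈-sym (mod (a ℤ./ℕ p) (ℤ.a≡a%ℕn+[a/ℕn]*n a p))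

  inverse : ∀ a → ¬ a ≈ + 0 → ∃ λ b → b ℤ.* a ≈ + 1
  inverse a a≉0 = bézout (coprime-Bézout (prime⇒coprime p-prime {{≢-nonZero r≢0}} (ℤ.n%ℕd<d a p)))
    where
    r = a ℤ.%ℕ p
    r≢0 : r ≢ 0
    r≢0 r≡0 = a≉0 (≈-trans (≈-sym (%-≈ a)) (reflexive (cong +_ r≡0)))
    lift : ∀ {x y} → 1 + y * r ≡ x * p → + 1 ℤ.+ + y ℤ.* + r ≡ + x ℤ.* + p
    lift {x} {y} eq = trans (cong (λ b → + 1 ℤ.+ b) (sym (ℤ.pos-* y r))) (trans (cong +_ eq) (ℤ.pos-* x p))
    lift′ : ∀ {x y} → 1 + x * p ≡ y * r → + 1 ℤ.+ + x ℤ.* + p ≡ + y ℤ.* + r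
    lift′ {x} {y} eq = trans (cong (λ b → + 1 ℤ.+ b) (sym (ℤ.pos-* x p))) (trans (cong +_ eq) (ℤ.pos-* y r))
    bézout : Bézout.Identity 1 p r → ∃ λ b → b ℤ.* a ≈ + 1
    bézout (Bézout.-+ x y eq) = + y , ≈-trans (*-cong (reflexive {+ y} refl) (≈-sym (%-≈ a))) (mod (+ x) (sym (lift′ {x} {y} eq)))
    -- In this case 1 + y r = x p, so y r is congruent to -1 and the inverse is -y.
    bézout (Bézout.+- x y eq) = ℤ.- + y , ≈-trans (*-cong (reflexive {ℤ.- + y} refl) (≈-sym (%-≈ a)))
      (mod (ℤ.- + x) (trans (negate (+ y) (+ r)) (trans (cong (λ b → + 1 ℤ.- b) (lift {x} {y} eq)) (distribute (+ x) (+ p)))))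
      where
      negate : ∀ y r → (ℤ.- y) ℤ.* r ≡ + 1 ℤ.- (+ 1 ℤ.+ y ℤ.* r)
      negate = ℤSolver.solve-∀
      distribute : ∀ x p → + 1 ℤ.- x ℤ.* p ≡ + 1 ℤ.+ (ℤ.- x) ℤ.* p
      distribute = ℤSolver.solve-∀

  -- The carrier is ℤ with congruence as its equality, so the ring laws are those of ℤ; only `index`
  -- picks representatives.
  field-of-integers : FiniteField p
  field-of-integers = record
    { commutativeRing = record { isCommutativeRing = isCommutativeRing }
    ; index           = λ a → Fin.fromℕ< (ℤ.n%ℕd<d a p)
    ; element         = λ i → + toℕ i
    ; index-cong      = λ {a} {b} a≈b → Fin.fromℕ<-cong _ _ (residue-unique (ℤ.n%ℕd<d a p) (ℤ.n%ℕd<d b p)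
                          (≈-trans (%-≈ a) (≈-trans a≈b (≈-sym (%-≈ b))))) _ _
    ; element-index   = λ a → ≈-trans (reflexive (cong +_ (Fin.toℕ-fromℕ< (ℤ.n%ℕd<d a p)))) (%-≈ a)
    ; index-element   = λ i → Fin.toℕ-injective (trans (Fin.toℕ-fromℕ< (ℤ.n%ℕd<d (+ toℕ i) p)) (m<n⇒m%n≡m (Fin.toℕ<n i)))
    ; 1≉0             = λ 1≈0 → contradiction (residue-unique (nonTrivial⇒n>1 p {{prime⇒nonTrivial p-prime}}) (>-nonZero⁻¹ p) 1≈0) λ ()
    ; inverse         = inverse
    }

-- Linear independence of any n rows

module IndependentRows {q : ℕ} (F : FiniteField q)
  {u s t n : ℕ} .{{_ : NonZero u}} (3u≤q : 3 * u ≤ q) (g : Fin u → Fin t → Fin s)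
  (expands : ∀ {S} (S? : Decidable S) → size S? ≤ n → 2 * size S? ≤ size (neighbour? g S?)) where
  open FiniteField F
  open LinearAlgebra F
  open Coefficients F {n = n} 3u≤q g expands public
  private module R = CommutativeRing commutativeRing

  a : Fin s → Fin u → Carrier
  a = proj₁ coefficients

  row : Fin u → Fin s → Carrier
  row x l = mask l (a l) x

  -- A dependency among the chosen rows, extended by zero to all keys, is a vector c with at most n
  -- nonzero entries and c A = 0, which `coefficients` excludes. Injectivity of x keeps the
  -- coefficients of different rows from adding up at one key, so c is nonzero.
  rows-onto : (x : Fin n → Fin u) → Injective _≡_ _≡_ x → Onto (λ i → row (x i))
  rows-onto x x-injective with dependent⊎onto n (λ i → row (x i))
  ... | inj₂ onto = onto
  ... | inj₁ (d , (i , dᵢ≉0) , Σ≈0) =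
    contradiction killed (proj₂ coefficients c (x i , λ ≈0 → dᵢ≉0 (R.trans (R.sym (c-x i)) ≈0)) small)
    where
    c : Fin u → Carrier
    c y = ⨁ λ i → single (x i) (d i) y

    c-x : ∀ i → c (x i) ≈ d i
    c-x i = R.trans (⨁-single i λ j j≢i → single-away (d j) (λ xᵢ≡xⱼ → j≢i (sym (x-injective xᵢ≡xⱼ)))) (single-at (x i) (d i))

    small : size (support? c) ≤ n
    small = begin
      size (support? c)                        ≤⟨ sum-mono {u} entry ⟩
      ∑[ y < u ] ∑[ i < n ] 𝟙 (x i Fin.≟ y)    ≡⟨ ∑-comm {u} {n} (λ y i → 𝟙 (x i Fin.≟ y)) ⟩
      ∑[ i < n ] size (x i Fin.≟_)             ≡⟨ sum-cong-≗ {n} (λ i → size-≟ (x i)) ⟩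
      ∑[ i < n ] 1                             ≡⟨ trans (sum-const n 1) (*-identityʳ n) ⟩
      n                                        ∎
      where
      open ≤-Reasoning
      entry : ∀ y → 𝟙 (support? c y) ≤ ∑[ i < n ] 𝟙 (x i Fin.≟ y)
      entry y with any? (λ i → x i Fin.≟ y)
      ... | yes (i , xᵢ≡y) = ≤-trans (𝟙≤1 (support? c y))
        (≤-trans (≤-reflexive (sym (𝟙-yes (x i Fin.≟ y) xᵢ≡y))) (term≤sum {n} (λ i → 𝟙 (x i Fin.≟ y)) i))
      ... | no y∉x = ≤-trans (≤-reflexive (𝟙-no (support? c y) λ ≉0 → ≉0 (⨁-zero λ i → single-away (d i) λ y≡xᵢ → y∉x (i , sym y≡xᵢ)))) z≤n

    killed : ∀ l → mask l c · a l ≈ 0#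
    killed l = begin
      mask l c · a l
        ≈⟨ ⨁-cong move ⟩
      (⨁ λ y → c y ⊗ row y l)
        ≈⟨ ⨁-cong (λ y → ⨁-*ʳ (row y l) (λ i → single (x i) (d i) y)) ⟩
      (⨁ λ y → ⨁ λ i → single (x i) (d i) y ⊗ row y l)
        ≈⟨ ⨁-comm (λ y i → single (x i) (d i) y ⊗ row y l) ⟩
      (⨁ λ i → ⨁ λ y → single (x i) (d i) y ⊗ row y l)
        ≈⟨ ⨁-cong (λ i → ⨁-single (x i) λ y y≢xᵢ → R.trans (R.*-congʳ (single-away (d i) y≢xᵢ)) (R.zeroˡ (row y l))) ⟩
      (⨁ λ i → single (x i) (d i) (x i) ⊗ row (x i) l)
        ≈⟨ ⨁-cong (λ i → R.*-congʳ (single-at (x i) (d i))) ⟩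
      (⨁ λ i → d i ⊗ row (x i) l)
        ≈⟨ Σ≈0 l ⟩
      0# ∎
      where
      open Relation.Binary.Reasoning.Setoid R.setoid
      -- The mask passes from c to the matrix entry.
      move : ∀ y → mask l c y ⊗ a l y ≈ c y ⊗ row y l
      move y with adjacent? y l
      ... | yes _ = R.refl
      ... | no _  = R.trans (R.zeroˡ _) (R.sym (R.zeroʳ _))

-- Queries with a fixed list of addresses

module _ {s w : ℕ} where

  probeAll : Vec (Fin s) k → (Vec (Word w) k → A) → Query s w A
  probeAll []       f = return (f [])
  probeAll (i ∷ is) f = probe i λ v → probeAll is λ vs → f (v ∷ vs)

  run-probeAll : ∀ (is : Vec (Fin s) k) (f : Vec (Word w) k → A) m → run (probeAll is f) m ≡ f (Vec.map (lookup m) is)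
  run-probeAll []       f m = refl
  run-probeAll (i ∷ is) f m = run-probeAll is _ m

  probed-probeAll : ∀ (is : Vec (Fin s) k) (f : Vec (Word w) k → A) m → probed (probeAll is f) m ≡ toList is
  probed-probeAll []       f m = refl
  probed-probeAll (i ∷ is) f m = cong (i List.∷_) (probed-probeAll is _ m)

-- Rational probabilities from counts

/-≡ : ∀ c d N M .{{_ : NonZero N}} .{{_ : NonZero M}} → c * M ≡ d * N → (ℤ.+ c) ℚ./ N ≡ (ℤ.+ d) ℚ./ M
/-≡ c d (suc N) (suc M) eq = ℚ.fromℚᵘ-cong {mkℚᵘ (ℤ.+ c) N} {mkℚᵘ (ℤ.+ d) M} (*≡* (trans (sym (ℤ.pos-* c (suc M))) (trans (cong ℤ.+_ eq) (ℤ.pos-* d (suc N)))))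

1/-* : ∀ m n .{{_ : NonZero m}} .{{_ : NonZero n}} → ((ℤ.+ 1) ℚ./ m) ℚ.* ((ℤ.+ 1) ℚ./ n) ≡ ℚ._/_ (ℤ.+ 1) (m * n) {{m*n≢0 m n}}
1/-* (suc m) (suc n) = ℚ.toℚᵘ-injective (begin
  toℚᵘ (x ℚ.* y)             ≈⟨ ℚ.toℚᵘ-homo-* x y ⟩
  toℚᵘ x ℚᵘ.* toℚᵘ y         ≈⟨ ℚᵘ.*-cong (ℚ.toℚᵘ-fromℚᵘ (mkℚᵘ (ℤ.+ 1) m)) (ℚ.toℚᵘ-fromℚᵘ (mkℚᵘ (ℤ.+ 1) n)) ⟩
  mkℚᵘ (ℤ.+ 1) (n + m * suc n) ≈⟨ ℚ.toℚᵘ-fromℚᵘ (mkℚᵘ (ℤ.+ 1) (n + m * suc n)) ⟨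
  toℚᵘ ((ℤ.+ 1) ℚ./ (suc m * suc n)) ∎)
  where
  open Relation.Binary.Reasoning.Setoid ℚᵘ.≃-setoid
  x = (ℤ.+ 1) ℚ./ suc m
  y = (ℤ.+ 1) ℚ./ suc n

∏-1/ : ∀ q k .{{_ : NonZero q}} → ∏ {k} (λ _ → (ℤ.+ 1) ℚ./ q) ≡ ℚ._/_ (ℤ.+ 1) (q ^ k) {{m^n≢0 q k}}
∏-1/ q zero    = refl
∏-1/ q (suc k) = trans (cong (((ℤ.+ 1) ℚ./ q) ℚ.*_) (∏-1/ q k)) (1/-* q (q ^ k) {{it}} {{m^n≢0 q k}})

Pr-size : ∀ {N} {{_ : NonZero N}} {E : Pred (Fin N) 0ℓ} (E? : Decidable E) M .{{_ : NonZero M}} → M * size E? ≡ N → Pr E? ≡ (ℤ.+ 1) ℚ./ M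
Pr-size {N} E? M eq = /-≡ (length (filter E? (allFin N))) 1 N M (trans (cong (_* M) (length-filter E? (λ i → i))) (trans (*-comm (size E?) M) (trans eq (sym (*-identityˡ N)))))

-- The data structure and its properties

module Structure {q : ℕ} (F : FiniteField q)
  {u s t n w : ℕ} .{{_ : NonZero u}} (3u≤q : 3 * u ≤ q) (g : Fin u → Fin t → Fin s)
  (expands : ∀ {S} (S? : Decidable S) → size S? ≤ n → 2 * size S? ≤ size (neighbour? g S?))
  (word : Fin q → Word w) (word-injective : Injective _≡_ _≡_ word) where
  open FiniteField F
  open LinearAlgebra F
  open IndependentRows F {n = n} 3u≤q g expands
  private
    module R = CommutativeRing commutativeRing
    instance
      q≢0 : NonZero q
      q≢0 = >-nonZero (≤-trans (>-nonZero⁻¹ u) (≤-trans (m≤m+n u _) 3u≤q))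

  decode : Word w → Carrier
  decode v with any? (λ i → Vec.≡-dec Bool._≟_ (word i) v)
  ... | yes (i , _) = element i
  -- An arbitrary default: cells filled by `initialise` always hold a word in the range of `word`.
  ... | no _        = 0#

  decode-word : ∀ i → decode (word i) ≡ element i
  decode-word i with any? (λ j → Vec.≡-dec Bool._≟_ (word j) (word i))
  ... | yes (j , same) = cong element (word-injective same)
  ... | no none        = contradiction (i , refl) none

  -- The t addresses of a key may coincide. Summing over cells l, with one probe j chosen for each
  -- adjacent cell, counts each cell once, as the product of row and seed does.
  summand : ∀ x → Vec (Word w) t → Fin s → Carrier
  summand x ws l with adjacent? x l
  ... | yes (j , _) = a l x ⊗ decode (lookup ws j)
  ... | no _        = 0#

  structure : HashStructure u q s w
  structure = record
    { seeds         = q ^ s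
    ; seeds-nonZero = m^n≢0 q s
    ; initialise    = λ σ → Vec.tabulate λ l → word (finToFun {q} {s} σ l)
    ; query         = λ x → probeAll (Vec.tabulate (g x)) λ ws → index (⨁ (summand x ws))
    }
  open HashStructure structure

  hash-row : ∀ x σ → hash x σ ≡ index (row x · vec {s} σ)
  hash-row x σ = trans (run-probeAll (Vec.tabulate (g x)) _ mem) (index-cong (⨁-cong entry))
    where
    mem = initialise σ
    entry : ∀ l → summand x (Vec.map (lookup mem) (Vec.tabulate (g x))) l ≈ row x l ⊗ vec {s} σ l
    entry l with adjacent? x l
    ... | no _           = R.sym (R.zeroˡ _)
    ... | yes (j , refl) = R.*-congˡ (R.reflexive (begin
      decode (lookup (Vec.map (lookup mem) (Vec.tabulate (g x))) j) ≡⟨ cong decode (Vec.lookup-map j (lookup mem) (Vec.tabulate (g x))) ⟩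
      decode (lookup mem (lookup (Vec.tabulate (g x)) j))           ≡⟨ cong (decode ∘ lookup mem) (Vec.lookup∘tabulate (g x) j) ⟩
      decode (lookup mem (g x j))                                   ≡⟨ cong decode (Vec.lookup∘tabulate _ (g x j)) ⟩
      decode (word (finToFun {q} {s} σ (g x j)))                    ≡⟨ decode-word _ ⟩
      element (finToFun {q} {s} σ (g x j))                          ∎))
      where open ≡-Reasoning

  nonAdaptive : NonAdaptive
  nonAdaptive x m m′ {i} = mk⇔ (subst (i ∈_) same) (subst (i ∈_) (sym same))
    where
    same : probed (query x) m ≡ probed (query x) m′
    same = trans (probed-probeAll (Vec.tabulate (g x)) _ m) (sym (probed-probeAll (Vec.tabulate (g x)) _ m′))

  queryTime : QueryTime≤ t
  queryTime x m = ≤-reflexive (trans (cong length (probed-probeAll (Vec.tabulate (g x)) _ m)) (Vec.length-toList (Vec.tabulate (g x))))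

  Pr-joint : ∀ (x : Fin k → Fin u) → Onto (λ i → row (x i)) → ∀ y →
    Pr {N = q ^ s} {{m^n≢0 q s}} (λ σ → all? (λ i → hash (x i) σ Fin.≟ y i)) ≡ ℚ._/_ (ℤ.+ 1) (q ^ k) {{m^n≢0 q k}}
  Pr-joint {k} x onto y = Pr-size {q ^ s} {{m^n≢0 q s}} _ (q ^ k) {{m^n≢0 q k}} (trans
    (cong (q ^ k *_) (sum-cong-≗ {q ^ s} λ σ → 𝟙-cong (all? (λ i → hash (x i) σ Fin.≟ y i)) (fibre? (λ i → row (x i)) y σ)
      (λ h i → trans (sym (hash-row (x i) σ)) (h i)) (λ h i → trans (hash-row (x i) σ) (h i))))
    (size-fibre (λ i → row (x i)) onto y))

  -- A single row of an onto family is onto by itself: demand the same value from every row. So the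
  -- marginals come from the same fibre count, with one row.
  Pr-single : ∀ {n} (x : Fin n → Fin u) → Onto (λ i → row (x i)) → ∀ i y →
    Pr {N = q ^ s} {{m^n≢0 q s}} (λ σ → hash (x i) σ Fin.≟ y) ≡ (ℤ.+ 1) ℚ./ q
  Pr-single x onto i y = Pr-size {q ^ s} {{m^n≢0 q s}} _ q (trans
    (cong₂ _*_ (sym (*-identityʳ q)) (sum-cong-≗ {q ^ s} λ σ → 𝟙-cong (hash (x i) σ Fin.≟ y) (fibre? {1} (λ _ → row (x i)) (λ _ → y) σ)
      (λ h _ → trans (sym (hash-row (x i) σ)) h) (λ h → trans (hash-row (x i) σ) (h zero))))
    (size-fibre {1} (λ _ → row (x i)) (λ z → proj₁ (onto λ _ → z zero) , λ { zero → proj₂ (onto λ _ → z zero) i }) (λ _ → y)))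

  wiseIndependent : WiseIndependent n structure
  wiseIndependent x x-injective =
    (λ y → trans (Pr-joint x onto y) (sym (trans (∏-cong λ i → Pr-single x onto i (y i)) (∏-1/ q n))))
    , λ i y → Pr-single x onto i y
    where onto = rows-onto x x-injective

-- Word size

wordOf : ∀ w → Fin (2 ^ w) → Word w
wordOf w i = Vec.tabulate (λ j → Inverse.to 2↔Bool (finToFun {2} {w} i j))

wordOf-injective : ∀ w → Injective _≡_ _≡_ (wordOf w)
wordOf-injective w {i} {j} eq = trans (sym (funToFin-finToFin {w} {2} i)) (trans
  (funToFin-cong w λ k → bit-injective (trans (sym (Vec.lookup∘tabulate _ k)) (trans (cong (λ v → lookup v k) eq) (Vec.lookup∘tabulate _ k))))
  (funToFin-finToFin {w} {2} j))
  where
  bit-injective : ∀ {a b} → Inverse.to 2↔Bool a ≡ Inverse.to 2↔Bool b → a ≡ b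
  bit-injective {a} {b} eq = trans (sym (Inverse.strictlyInverseʳ 2↔Bool a)) (trans (cong (Inverse.from 2↔Bool) eq) (Inverse.strictlyInverseʳ 2↔Bool b))

-- Passing from p to p + 1, w grows only when the 2ʷ words are exhausted, and at that moment 2ʷ ≤ p;
-- this keeps the upper bound.
wordLength : ∀ p → .{{_ : NonZero p}} → ∃ λ w → p ≤ 2 ^ w × 2 ^ w ≤ 2 * p
wordLength (suc zero) = 0 , ≤-refl , s≤s z≤n
wordLength (suc p@(suc _)) with w , lower , upper ← wordLength p | suc p ≤? 2 ^ w
... | yes fits = w , fits , ≤-trans upper (*-monoʳ-≤ 2 (n≤1+n p))
... | no full  = suc w , doubled , *-monoʳ-≤ 2 (≤-trans (≮⇒≥ full) (n≤1+n p))
  where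
  doubled : suc p ≤ 2 * 2 ^ w
  doubled = begin
    1 + p             ≤⟨ +-mono-≤ (m^n>0 2 w) lower ⟩
    2 ^ w + 2 ^ w     ≡⟨ cong (2 ^ w +_) (+-identityʳ (2 ^ w)) ⟨
    2 * 2 ^ w         ∎
    where open ≤-Reasoning

m≤2^m : ∀ m → m ≤ 2 ^ m
m≤2^m zero    = z≤n
m≤2^m (suc m) = begin
  1 + m           ≤⟨ +-mono-≤ (m^n>0 2 m) (m≤2^m m) ⟩
  2 ^ m + 2 ^ m   ≡⟨ cong (2 ^ m +_) (+-identityʳ (2 ^ m)) ⟨
  2 * 2 ^ m       ∎
  where open ≤-Reasoning

-- The search descends from m and stops above the first failure it meets. Failure at the predecessor
-- is the only form of minimality that `unreached` requires.
least : {P : Pred ℕ 0ℓ} → Decidable P → ∀ m → P m → ∃ λ k → P k × (∀ j → k ≡ suc j → ¬ P j)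
least P? zero    p₀ = zero , p₀ , λ _ ()
least P? (suc m) p with P? m
... | yes pₘ = least P? m pₘ
... | no ¬pₘ = suc m , p , λ { _ refl → ¬pₘ }

-- The number of probes

module _ (n u s : ℕ) .{{_ : NonZero n}} (n≤u : n ≤ u) (256n≤s : 256 * n ≤ s) where

  private
    -- That is, u/n ≤ (s/2n)ᵖ with exponent ρ: each probe gains a factor s/2n, and ρ of them pay for
    -- u/n.
    Reaches : ℕ → Set
    Reaches ρ = u * (2 * n) ^ ρ ≤ s ^ ρ * n

    4n≤s : 4 * n ≤ s
    4n≤s = ≤-trans (*-monoˡ-≤ n (≤ᵇ⇒≤ 4 256 _)) 256n≤s

    instance
      s≢0 : NonZero s
      s≢0 = >-nonZero (≤-trans (>-nonZero⁻¹ n) (≤-trans (m≤m+n n _) 4n≤s))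

    -- A crude starting point for the search: s/2n ≥ 2 and u ≤ 2ᵘ.
    reaches-u : Reaches u
    reaches-u = begin
      u * (2 * n) ^ u       ≤⟨ *-monoˡ-≤ ((2 * n) ^ u) (m≤2^m u) ⟩
      2 ^ u * (2 * n) ^ u   ≡⟨ ^-distribʳ-* u 2 (2 * n) ⟨
      (2 * (2 * n)) ^ u     ≡⟨ cong (_^ u) (*-assoc 2 2 n) ⟨
      (4 * n) ^ u           ≤⟨ ^-monoˡ-≤ u 4n≤s ⟩
      s ^ u                 ≤⟨ m≤m*n (s ^ u) n ⟩
      s ^ u * n             ∎
      where open ≤-Reasoning

    shortest : ∃ λ ρ → Reaches ρ × (∀ j → ρ ≡ suc j → ¬ Reaches j)
    shortest = least (λ ρ → u * (2 * n) ^ ρ ≤? s ^ ρ * n) u reaches-u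

    -- (s/n)ʲ ≤ (u/n)² whenever (s/2n)ʲ < u/n, because s/n ≤ (s/2n)².
    unreached : ∀ j → ¬ Reaches j → s ^ j * (n * n) ≤ u * u * n ^ j
    unreached j short = *-cancelʳ-≤ _ _ (s ^ j) {{m^n≢0 s j}} (begin
      s ^ j * (n * n) * s ^ j                 ≡⟨ square (s ^ j) n ⟩
      s ^ j * n * (s ^ j * n)                 ≤⟨ *-mono-≤ (<⇒≤ (≰⇒> short)) (<⇒≤ (≰⇒> short)) ⟩
      u * (2 * n) ^ j * (u * (2 * n) ^ j)     ≡⟨ square′ u ((2 * n) ^ j) ⟩
      u * u * ((2 * n) ^ j * (2 * n) ^ j)     ≡⟨ cong (u * u *_) (^-distribʳ-* j (2 * n) (2 * n)) ⟨
      u * u * (2 * n * (2 * n)) ^ j           ≡⟨ cong (λ x → u * u * x ^ j) (four n) ⟩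
      u * u * (n * (4 * n)) ^ j               ≤⟨ *-monoʳ-≤ (u * u) (^-monoˡ-≤ j (*-monoʳ-≤ n 4n≤s)) ⟩
      u * u * (n * s) ^ j                     ≡⟨ cong (u * u *_) (^-distribʳ-* j n s) ⟩
      u * u * (n ^ j * s ^ j)                 ≡⟨ *-assoc (u * u) (n ^ j) (s ^ j) ⟨
      u * u * n ^ j * s ^ j                   ∎)
      where
      open ≤-Reasoning
      square : ∀ a n → a * (n * n) * a ≡ a * n * (a * n)
      square = solve-∀
      square′ : ∀ a b → a * b * (a * b) ≡ a * a * (b * b)
      square′ = solve-∀
      four : ∀ n → 2 * n * (2 * n) ≡ n * (4 * n)
      four = solve-∀

  depth : ℕ
  depth = proj₁ shortest

  -- One probe beyond `depth` gains another factor s/2n, which is at least 128 because s ≥ 256 n;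
  -- this is the origin of 256.
  dense : 128 * u * (2 * n) ^ suc depth ≤ s ^ suc depth * n
  dense = begin
    128 * u * (2 * n * (2 * n) ^ depth)    ≡⟨ regroup u n ((2 * n) ^ depth) ⟩
    256 * n * (u * (2 * n) ^ depth)        ≤⟨ *-mono-≤ 256n≤s (proj₁ (proj₂ shortest)) ⟩
    s * (s ^ depth * n)                    ≡⟨ *-assoc s (s ^ depth) n ⟨
    s * s ^ depth * n                      ∎
    where
    open ≤-Reasoning
    regroup : ∀ u n x → 128 * u * (2 * n * x) ≡ 256 * n * (u * x)
    regroup = solve-∀

  -- For depth j + 1 there are 4 + j probes: (s/n)ʲ ≤ (u/n)² by `unreached`, so (s/n)⁴⁺ʲ ≤ (s/n)⁴
  -- (u/n)², and n ≤ u supplies the two missing factors u/n. Depth 0 leaves three probes, within the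
  -- exponent 4 since n ≤ s and n ≤ u.
  probeBound : ProbeBound 4 n u s (3 + depth)
  probeBound = bound depth (proj₂ (proj₂ shortest))
    where
    open ≤-Reasoning
    n≤s : n ≤ s
    n≤s = ≤-trans (m≤m+n n _) 4n≤s
    bound : ∀ ρ → (∀ j → ρ ≡ suc j → ¬ Reaches j) → ProbeBound 4 n u s (3 + ρ)
    bound zero    _     = begin
      s ^ 3 * (n * n) ^ 4                  ≡⟨ split s n ⟩
      s ^ 3 * n ^ 3 * (n * (n * n * (n * n))) ≤⟨ *-monoʳ-≤ (s ^ 3 * n ^ 3) (*-mono-≤ n≤s (*-mono-≤ nn≤uu nn≤uu)) ⟩
      s ^ 3 * n ^ 3 * (s * (u * u * (u * u))) ≡⟨ join s n u ⟩
      (s * u) ^ 4 * n ^ 3                  ∎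
      where
      nn≤uu : n * n ≤ u * u
      nn≤uu = *-mono-≤ n≤u n≤u
      split : ∀ s n → s * (s * (s * 1)) * (n * n * (n * n * (n * n * (n * n * 1)))) ≡ s * (s * (s * 1)) * (n * (n * (n * 1))) * (n * (n * n * (n * n)))
      split = solve-∀
      join : ∀ s n u → s * (s * (s * 1)) * (n * (n * (n * 1))) * (s * (u * u * (u * u))) ≡ s * u * (s * u * (s * u * (s * u * 1))) * (n * (n * (n * 1)))
      join = solve-∀
    bound (suc j) short = begin
      s ^ (4 + j) * (n * n) ^ 4            ≡⟨ split s n (s ^ j) ⟩
      s ^ 4 * n ^ 4 * (s ^ j * (n * n)) * (n * n) ≤⟨ *-mono-≤ (*-monoʳ-≤ (s ^ 4 * n ^ 4) (unreached j (short j refl))) (*-mono-≤ n≤u n≤u) ⟩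
      s ^ 4 * n ^ 4 * (u * u * n ^ j) * (u * u)   ≡⟨ join s n u (n ^ j) ⟩
      (s * u) ^ 4 * n ^ (4 + j)            ∎
      where
      split : ∀ s n x → s * (s * (s * (s * x))) * (n * n * (n * n * (n * n * (n * n * 1)))) ≡ s * (s * (s * (s * 1))) * (n * (n * (n * (n * 1)))) * (x * (n * n)) * (n * n)
      split = solve-∀
      join : ∀ s n u x → s * (s * (s * (s * 1))) * (n * (n * (n * (n * 1)))) * (u * u * x) * (u * u) ≡ s * u * (s * u * (s * u * (s * u * 1))) * (n * (n * (n * (n * x))))
      join = solve-∀

-- Assembling the constants and the structure

theorem3 : ∃[ cₛ ] ∃[ cₚ ] ∃[ a ] ∃[ b ] ∃[ c ] (2 ≤ cₛ ×
    (∀ (n u s p : ℕ) → 1 ≤ n → n ≤ u → cₛ * n ≤ s → Prime p → cₚ * u ≤ p →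
    ∃[ w ] ∃[ t ] (WordSize a b w p × ProbeBound c n u s t ×
    (Σ[ D ∈ HashStructure u p s w ]
    (HashStructure.NonAdaptive D ×
    HashStructure.QueryTime≤ D t ×
    WiseIndependent n D)))))
-- 256 comes from `dense`, 3 from the union bound over coefficient vectors, 4 from `probeBound`. The
-- word bounds 1 and 2 hold because p ≤ 2ʷ ≤ 2p ≤ p².
theorem3 = 256 , 3 , 1 , 2 , 4 , s≤s (s≤s z≤n) , build
  where
  build : ∀ (n u s p : ℕ) → 1 ≤ n → n ≤ u → 256 * n ≤ s → Prime p → 3 * u ≤ p →
    ∃[ w ] ∃[ t ] (WordSize 1 2 w p × ProbeBound 4 n u s t ×
    (Σ[ D ∈ HashStructure u p s w ]
    (HashStructure.NonAdaptive D ×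
    HashStructure.QueryTime≤ D t ×
    WiseIndependent n D)))
  build n u s p 1≤n n≤u 256n≤s p-prime 3u≤p =
    w , 3 + depth n u s n≤u 256n≤s , (p≤2^w , 2^w≤p^2) , probeBound n u s n≤u 256n≤s ,
    S.structure , S.nonAdaptive , S.queryTime , S.wiseIndependent
    where
    n≤s : n ≤ s
    n≤s = ≤-trans (m≤m+n n _) 256n≤s
    instance
      n≢0 : NonZero n
      n≢0 = >-nonZero 1≤n
      u≢0 : NonZero u
      u≢0 = >-nonZero (≤-trans 1≤n n≤u)
      s≢0 : NonZero s
      s≢0 = >-nonZero (≤-trans 1≤n n≤s)
      p≢0 : NonZero p
      p≢0 = prime⇒nonZero p-prime
    w = proj₁ (wordLength p)
    fits : p ≤ 2 ^ w
    fits = proj₁ (proj₂ (wordLength p))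
    p≤2^w : p ≤ 2 ^ (1 * w)
    p≤2^w = subst (λ e → p ≤ 2 ^ e) (sym (*-identityˡ w)) fits
    2^w≤p^2 : 2 ^ w ≤ p ^ 2
    2^w≤p^2 = begin
      2 ^ w       ≤⟨ proj₂ (proj₂ (wordLength p)) ⟩
      2 * p       ≤⟨ *-monoˡ-≤ p (nonTrivial⇒n>1 p {{prime⇒nonTrivial p-prime}}) ⟩
      p * p       ≡⟨ cong (p *_) (*-identityʳ p) ⟨
      p ^ 2       ∎
      where open ≤-Reasoning
    graph-expands = expander n u s (depth n u s n≤u 256n≤s) n≤u n≤s (dense n u s n≤u 256n≤s)
    module S = Structure (IntegersModulo.field-of-integers p p-prime) {n = n} 3u≤p (proj₁ graph-expands) (proj₂ graph-expands)
      (λ i → wordOf w (Fin.inject≤ i fits)) (λ eq → inject≤-injective fits fits _ _ (wordOf-injective w eq))
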